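{- Let $0 < c < \frac{1}{2}$ be fixed, and let $t$ be a large integer. There exists a graph $G$ of treewidth $t$ and clique number $\lfloor (1 - c)t \rfloor$ satisfying \[ \chi_f(G) \geq t + 1 + \frac{1}{2}\log (1-2c) - o(1).\] That is: for every fixed $c \in (0,\frac12)$ and every $\varepsilon > 0$ there is $t_0$ such that for every integer $t \geq t_0$ there exists a graph $G$ of treewidth $t$ and clique number $\lfloor (1-c)t \rfloor$ with $\chi_f(G) \geq t + 1 + \frac{1}{2}\log(1-2c) - \varepsilon$.
   Context: Graphs are finite and simple. $\log$ is the natural logarithm, and $o(1)$ denotes a quantity tending to $0$ as $t \to \infty$ with $c$ fixed. The clique number of $G$ is the number of vertices in a largest clique of $G$. A $t$-tree is a graph obtained by starting with a $t$-clique and then iteratively adding vertices $v$ such that, at the time $v$ is added, its neighborhood $N(v)$ induces a $K_t$. A partial $t$-tree is a subgraph of a $t$-tree. The treewidth of $G$ is the minimum $t$ for which $G$ is a partial $t$-tree (this agrees with the usual definition of treewidth). A fractional coloring of $G$ assigns to each vertex $v \in V(G)$ a set $\phi(v) \subseteq \mathbb{R}$ of Lebesgue measure $\mu(\phi(v)) = 1$ so that $\phi(u) \cap \phi(v) = \emptyset$ for each edge $uv \in E(G)$. The fractional chromatic number $\chi_f(G)$ is the infimum of $\mu\left(\bigcup_{v \in V(G)} \phi(v)\right)$ over all fractional colorings $\phi$ of $G$. Equivalently, $\chi_f(G) = \inf_{b \geq 1} \chi_b(G)/b$, where $\chi_b(G)$ is the least $k$ such that one can assign to each vertex a $b$-element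 subset of $\{1,\dots,k\}$ with adjacent vertices receiving disjoint subsets. -}

module Defs where

open import Data.Empty using (⊥)
open import Data.Fin.Base using (Fin; zero; suc)
import Data.Fin.Properties as Fin
open import Data.Fin.Subset using (Subset; _∈_; _∩_; Empty; ∣_∣)
open import Data.Fin.Subset.Properties using (_∈?_)
open import Data.Integer.Base using (+_)
open import Data.Nat.Base as ℕ using (ℕ; zero; suc; _⊔_; _!)
import Data.Nat.Properties as ℕ
open import Data.Product using (Σ; ∃-syntax; _×_; _,_)
open import Data.Rational.Base as ℚ using (ℚ; 0ℚ; 1ℚ; ½)
import Data.Rational.Properties as ℚ
open import Data.Rational.Solver using (module +-*-Solver)
open import Function.Definitions using (Injective)
open import Level using (0ℓ)
open import Relation.Binary.Core using (Rel)
open import Relation.Binary.Definitions using (Decidable)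
open import Relation.Binary.PropositionalEquality
  using (_≡_; _≢_; refl; sym; cong; cong₂; subst)
open import Relation.Nullary.Decidable using (no; ¬?)

------------------------------------------------------------------------
-- Real numbers: Cauchy sequences of rationals, compared up to _≃_

IsCauchy : (ℕ → ℚ) → Set
IsCauchy s = ∀ ε → 0ℚ ℚ.< ε →
  ∃[ N ] ∀ m n → N ℕ.≤ m → N ℕ.≤ n → ℚ.∣ s m ℚ.- s n ∣ ℚ.≤ ε

record ℝ : Set where
  constructor mkℝ
  field
    seq    : ℕ → ℚ
    cauchy : IsCauchy seq

open ℝ public

private
  open ℚ.≤-Reasoning
  open +-*-Solver using (solve; _:=_; _:+_; :-_)

  abstract
    half-pos : ∀ {ε} → 0ℚ ℚ.< ε → 0ℚ ℚ.< ε ℚ.* ½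
    half-pos {ε} 0<ε = subst (ℚ._< ε ℚ.* ½) (ℚ.*-zeroˡ ½) (ℚ.*-monoˡ-<-pos ½ 0<ε)

    half+half : ∀ ε → ε ℚ.* ½ ℚ.+ ε ℚ.* ½ ≡ ε
    half+half ε = begin-equality
      ε ℚ.* ½ ℚ.+ ε ℚ.* ½ ≡⟨ ℚ.*-distribˡ-+ ε ½ ½ ⟨
      ε ℚ.* 1ℚ            ≡⟨ ℚ.*-identityʳ ε ⟩
      ε                   ∎

    +-cauchy : ∀ s t → IsCauchy s → IsCauchy t → IsCauchy (λ n → s n ℚ.+ t n)
    +-cauchy s t cs ct ε 0<ε
      with cs (ε ℚ.* ½) (half-pos 0<ε) | ct (ε ℚ.* ½) (half-pos 0<ε)
    ... | M , hM | N , hN = M ⊔ N , λ m n p q → begin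
      ℚ.∣ (s m ℚ.+ t m) ℚ.- (s n ℚ.+ t n) ∣
        ≡⟨ cong ℚ.∣_∣ (solve 4 (λ a b c d → (a :+ b) :+ :- (c :+ d) := (a :+ :- c) :+ (b :+ :- d))
             refl (s m) (t m) (s n) (t n)) ⟩
      ℚ.∣ (s m ℚ.- s n) ℚ.+ (t m ℚ.- t n) ∣
        ≤⟨ ℚ.∣p+q∣≤∣p∣+∣q∣ (s m ℚ.- s n) (t m ℚ.- t n) ⟩
      ℚ.∣ s m ℚ.- s n ∣ ℚ.+ ℚ.∣ t m ℚ.- t n ∣
        ≤⟨ ℚ.+-mono-≤ (hM m n (ℕ.m⊔n≤o⇒m≤o M N p) (ℕ.m⊔n≤o⇒m≤o M N q))
                      (hN m n (ℕ.m⊔n≤o⇒n≤o M N p) (ℕ.m⊔n≤o⇒n≤o M N q)) ⟩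
      ε ℚ.* ½ ℚ.+ ε ℚ.* ½
        ≡⟨ half+half ε ⟩
      ε ∎

    neg-cauchy : ∀ s → IsCauchy s → IsCauchy (λ n → ℚ.- s n)
    neg-cauchy s cs ε 0<ε with cs ε 0<ε
    ... | N , h = N , λ m n p q → begin
      ℚ.∣ ℚ.- s m ℚ.- ℚ.- s n ∣
        ≡⟨ cong ℚ.∣_∣ (solve 2 (λ a b → :- a :+ :- (:- b) := b :+ :- a) refl (s m) (s n)) ⟩
      ℚ.∣ s n ℚ.- s m ∣
        ≤⟨ h n m q p ⟩
      ε ∎

    const-cauchy : ∀ q → IsCauchy (λ _ → q)
    const-cauchy q ε 0<ε = 0 , λ _ _ _ _ → begin
      ℚ.∣ q ℚ.- q ∣ ≡⟨ cong ℚ.∣_∣ (ℚ.+-inverseʳ q) ⟩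
      0ℚ            <⟨ 0<ε ⟩
      ε             ∎

    eventually-bounded : ∀ {s} → IsCauchy s →
      ∃[ B ] ℚ.Positive B × (∃[ N ] ∀ n → N ℕ.≤ n → ℚ.∣ s n ∣ ℚ.≤ B)
    eventually-bounded {s} cs with cs 1ℚ (ℚ.positive⁻¹ 1ℚ)
    ... | N , h = B , B-pos , N , λ n p → begin
      ℚ.∣ s n ∣
        ≡⟨ cong ℚ.∣_∣ (solve 2 (λ a b → a := (a :+ :- b) :+ b) refl (s n) (s N)) ⟩
      ℚ.∣ (s n ℚ.- s N) ℚ.+ s N ∣
        ≤⟨ ℚ.∣p+q∣≤∣p∣+∣q∣ (s n ℚ.- s N) (s N) ⟩
      ℚ.∣ s n ℚ.- s N ∣ ℚ.+ ℚ.∣ s N ∣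
        ≤⟨ ℚ.+-monoˡ-≤ ℚ.∣ s N ∣ (h n N p ℕ.≤-refl) ⟩
      B ∎
      where
      B : ℚ
      B = 1ℚ ℚ.+ ℚ.∣ s N ∣
      B-pos : ℚ.Positive B
      B-pos = ℚ.pos+nonNeg⇒pos 1ℚ ℚ.∣ s N ∣ {{ℚ.∣-∣-nonNeg (s N)}}

    *-bound : ∀ a B δ p → .{{ℚ.Positive B}} → ℚ.∣ a ∣ ℚ.≤ B → ℚ.∣ p ∣ ℚ.≤ δ →
      ℚ.∣ a ℚ.* p ∣ ℚ.≤ δ ℚ.* B
    *-bound a B δ p a≤B p≤δ = begin
      ℚ.∣ a ℚ.* p ∣         ≡⟨ ℚ.∣p*q∣≡∣p∣*∣q∣ a p ⟩
      ℚ.∣ a ∣ ℚ.* ℚ.∣ p ∣   ≤⟨ ℚ.*-monoʳ-≤-nonNeg ℚ.∣ p ∣ {{ℚ.∣-∣-nonNeg p}} a≤B ⟩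
      B ℚ.* ℚ.∣ p ∣         ≤⟨ ℚ.*-monoˡ-≤-nonNeg B {{ℚ.pos⇒nonNeg B}} p≤δ ⟩
      B ℚ.* δ               ≡⟨ ℚ.*-comm B δ ⟩
      δ ℚ.* B               ∎

    divide : ∀ η B → .{{ℚ.Positive B}} → 0ℚ ℚ.< η → ∃[ δ ] 0ℚ ℚ.< δ × δ ℚ.* B ≡ η
    divide η B {{pB}} 0<η = δ , ℚ.positive⁻¹ δ {{δ-pos}} , eq
      where
      instance
        B≢0 : ℚ.NonZero B
        B≢0 = ℚ.pos⇒nonZero B
      δ : ℚ
      δ = η ℚ.* ℚ.1/ B
      δ-pos : ℚ.Positive δ
      δ-pos = ℚ.pos*pos⇒pos η {{ℚ.positive 0<η}} (ℚ.1/ B) {{ℚ.1/pos⇒pos B}}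
      eq : δ ℚ.* B ≡ η
      eq = begin-equality
        η ℚ.* ℚ.1/ B ℚ.* B   ≡⟨ ℚ.*-assoc η (ℚ.1/ B) B ⟩
        η ℚ.* (ℚ.1/ B ℚ.* B) ≡⟨ cong (η ℚ.*_) (ℚ.*-inverseˡ B) ⟩
        η ℚ.* 1ℚ             ≡⟨ ℚ.*-identityʳ η ⟩
        η                    ∎

    *-difference : ∀ a b c d →
      a ℚ.* b ℚ.- c ℚ.* d ≡ a ℚ.* (b ℚ.- d) ℚ.+ d ℚ.* (a ℚ.- c)
    *-difference a b c d = begin-equality
      a ℚ.* b ℚ.- c ℚ.* d
        ≡⟨ solve 3 (λ x y z → x :+ :- z := (x :+ :- y) :+ (y :+ :- z))
             refl (a ℚ.* b) (a ℚ.* d) (c ℚ.* d) ⟩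
      (a ℚ.* b ℚ.- a ℚ.* d) ℚ.+ (a ℚ.* d ℚ.- c ℚ.* d)
        ≡⟨ cong₂ (λ x y → (a ℚ.* b ℚ.- a ℚ.* d) ℚ.+ (x ℚ.- y)) (ℚ.*-comm a d) (ℚ.*-comm c d) ⟩
      (a ℚ.* b ℚ.- a ℚ.* d) ℚ.+ (d ℚ.* a ℚ.- d ℚ.* c)
        ≡⟨ cong₂ ℚ._+_ (factor a b d) (factor d a c) ⟩
      a ℚ.* (b ℚ.- d) ℚ.+ d ℚ.* (a ℚ.- c) ∎
      where
      factor : ∀ x y z → x ℚ.* y ℚ.- x ℚ.* z ≡ x ℚ.* (y ℚ.- z)
      factor x y z = begin-equality
        x ℚ.* y ℚ.- x ℚ.* z          ≡⟨ cong (x ℚ.* y ℚ.+_) (ℚ.neg-distribʳ-* x z) ⟩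
        x ℚ.* y ℚ.+ x ℚ.* (ℚ.- z)    ≡⟨ ℚ.*-distribˡ-+ x y (ℚ.- z) ⟨
        x ℚ.* (y ℚ.- z)              ∎

    *-difference-bound : ∀ {a b c d A B α β} → .{{ℚ.Positive A}} → .{{ℚ.Positive B}} →
      ℚ.∣ a ∣ ℚ.≤ A → ℚ.∣ d ∣ ℚ.≤ B → ℚ.∣ b ℚ.- d ∣ ℚ.≤ α → ℚ.∣ a ℚ.- c ∣ ℚ.≤ β →
      ℚ.∣ a ℚ.* b ℚ.- c ℚ.* d ∣ ℚ.≤ α ℚ.* A ℚ.+ β ℚ.* B
    *-difference-bound {a} {b} {c} {d} {A} {B} {α} {β} a≤A d≤B b-d≤α a-c≤β = begin
      ℚ.∣ a ℚ.* b ℚ.- c ℚ.* d ∣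
        ≡⟨ cong ℚ.∣_∣ (*-difference a b c d) ⟩
      ℚ.∣ a ℚ.* (b ℚ.- d) ℚ.+ d ℚ.* (a ℚ.- c) ∣
        ≤⟨ ℚ.∣p+q∣≤∣p∣+∣q∣ (a ℚ.* (b ℚ.- d)) (d ℚ.* (a ℚ.- c)) ⟩
      ℚ.∣ a ℚ.* (b ℚ.- d) ∣ ℚ.+ ℚ.∣ d ℚ.* (a ℚ.- c) ∣
        ≤⟨ ℚ.+-mono-≤ (*-bound a A α (b ℚ.- d) a≤A b-d≤α) (*-bound d B β (a ℚ.- c) d≤B a-c≤β) ⟩
      α ℚ.* A ℚ.+ β ℚ.* B ∎

    *-cauchy : ∀ s t → IsCauchy s → IsCauchy t → IsCauchy (λ n → s n ℚ.* t n)
    *-cauchy s t cs ct ε 0<ε =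
      let
        A , A-pos , K , hK = eventually-bounded cs
        B , B-pos , L , hL = eventually-bounded ct
        α , 0<α , αA≡      = divide (ε ℚ.* ½) A {{A-pos}} (half-pos 0<ε)
        β , 0<β , βB≡      = divide (ε ℚ.* ½) B {{B-pos}} (half-pos 0<ε)
        M , hM             = cs β 0<β
        N , hN             = ct α 0<α
        total : α ℚ.* A ℚ.+ β ℚ.* B ≡ ε
        total = subst (α ℚ.* A ℚ.+ β ℚ.* B ≡_) (half+half ε) (cong₂ ℚ._+_ αA≡ βB≡)
      in (K ⊔ L) ⊔ (M ⊔ N) , λ m n p q →
        let
          p₁ = ℕ.m⊔n≤o⇒m≤o (K ⊔ L) (M ⊔ N) p
          p₂ = ℕ.m⊔n≤o⇒n≤o (K ⊔ L) (M ⊔ N) p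
          q₁ = ℕ.m⊔n≤o⇒m≤o (K ⊔ L) (M ⊔ N) q
          q₂ = ℕ.m⊔n≤o⇒n≤o (K ⊔ L) (M ⊔ N) q
        in subst (ℚ.∣ s m ℚ.* t m ℚ.- s n ℚ.* t n ∣ ℚ.≤_) total
             (*-difference-bound {s m} {t m} {s n} {t n} {A} {B} {α} {β} {{A-pos}} {{B-pos}}
               (hK m (ℕ.m⊔n≤o⇒m≤o K L p₁))
               (hL n (ℕ.m⊔n≤o⇒n≤o K L q₁))
               (hN m n (ℕ.m⊔n≤o⇒n≤o M N p₂) (ℕ.m⊔n≤o⇒n≤o M N q₂))
               (hM m n (ℕ.m⊔n≤o⇒m≤o M N p₂) (ℕ.m⊔n≤o⇒m≤o M N q₂)))

infixl 6 _+_ _-_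
infixl 7 _*_
infixr 8 _^_
infix  8 -_
infix  4 _<_ _≤_ _≃_

fromℚ : ℚ → ℝ
fromℚ q = mkℝ (λ _ → q) (const-cauchy q)

fromℕ : ℕ → ℝ
fromℕ n = fromℚ (+ n ℚ./ 1)

_+_ : ℝ → ℝ → ℝ
x + y = mkℝ (λ n → seq x n ℚ.+ seq y n) (+-cauchy (seq x) (seq y) (cauchy x) (cauchy y))

-_ : ℝ → ℝ
- x = mkℝ (λ n → ℚ.- seq x n) (neg-cauchy (seq x) (cauchy x))

_-_ : ℝ → ℝ → ℝ
x - y = x + (- y)

_*_ : ℝ → ℝ → ℝ
x * y = mkℝ (λ n → seq x n ℚ.* seq y n) (*-cauchy (seq x) (seq y) (cauchy x) (cauchy y))

_^_ : ℝ → ℕ → ℝ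
x ^ zero  = fromℕ 1
x ^ suc n = x * x ^ n

-- Strict inequality needs a positive rational gap uniform in n: pointwise strict
-- inequality of the approximations would not exclude equal limits.
_<_ : ℝ → ℝ → Set
x < y = ∃[ δ ] 0ℚ ℚ.< δ × ∃[ N ] ∀ n → N ℕ.≤ n → seq x n ℚ.+ δ ℚ.≤ seq y n

_≤_ : ℝ → ℝ → Set
x ≤ y = ∀ δ → 0ℚ ℚ.< δ → ∃[ N ] ∀ n → N ℕ.≤ n → seq x n ℚ.≤ seq y n ℚ.+ δ

_≃_ : ℝ → ℝ → Set
x ≃ y = x ≤ y × y ≤ x

_ConvergesTo_ : (ℕ → ℝ) → ℝ → Set
f ConvergesTo x = ∀ ε → fromℕ 0 < ε →
  ∃[ N ] ∀ n → N ℕ.≤ n → (f n < x + ε) × (x < f n + ε)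

expPartialSum : ℝ → ℕ → ℝ
expPartialSum x zero    = fromℕ 1
expPartialSum x (suc n) =
  expPartialSum x n + x ^ suc n * fromℚ (ℚ._/_ (+ 1) (suc n !) {{suc n ℕ.!≢0}})

-- ℓ = log x, i.e. exp ℓ = Σ ℓⁿ/n! = x.
IsLog : ℝ → ℝ → Set
IsLog x ℓ = expPartialSum ℓ ConvergesTo x

-- k = ⌊x⌋, for x ≥ 0. A relation, because the floor is not a computable function of
-- a Cauchy real.
IsFloor : ℝ → ℕ → Set
IsFloor x k = (fromℕ k ≤ x) × (x < fromℕ k + fromℕ 1)

IsInfimum : (ℝ → Set) → ℝ → Set
IsInfimum S x = (∀ y → S y → x ≤ y) × (∀ z → (∀ y → S y → z ≤ y) → z ≤ x)

------------------------------------------------------------------------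
-- Graphs

record Graph : Set₁ where
  field
    order  : ℕ
    Adj    : Rel (Fin order) 0ℓ
    adj?   : Decidable Adj
    symm   : ∀ {u v} → Adj u v → Adj v u
    irrefl : ∀ {v} → Adj v v → ⊥

open Graph public

Vertex : Graph → Set
Vertex G = Fin (order G)

IsClique : (G : Graph) → Subset (order G) → Set
IsClique G S = ∀ {u v} → u ∈ S → v ∈ S → u ≢ v → Adj G u v

IsCliqueNumber : Graph → ℕ → Set
IsCliqueNumber G ω =
  (∃[ S ] IsClique G S × ∣ S ∣ ≡ ω) × (∀ S → IsClique G S → ∣ S ∣ ℕ.≤ ω)

complete : ℕ → Graph
complete n = record
  { order  = n
  ; Adj    = _≢_
  ; adj?   = λ u v → ¬? (u Fin.≟ v)
  ; symm   = λ u≢v v≡u → u≢v (sym v≡u)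
  ; irrefl = λ v≢v → v≢v refl
  }

-- The new vertex is zero and its neighbourhood is S.
addVertex : (G : Graph) → Subset (order G) → Graph
addVertex G S = record
  { order  = suc (order G)
  ; Adj    = A
  ; adj?   = A?
  ; symm   = λ {u} {v} → A-sym u v
  ; irrefl = λ {v} → A-irrefl v
  }
  where
  A : Rel (Fin (suc (order G))) 0ℓ
  A zero    zero    = ⊥
  A zero    (suc v) = v ∈ S
  A (suc u) zero    = u ∈ S
  A (suc u) (suc v) = Adj G u v

  A? : Decidable A
  A? zero    zero    = no λ ()
  A? zero    (suc v) = v ∈? S
  A? (suc u) zero    = u ∈? S
  A? (suc u) (suc v) = adj? G u v

  A-sym : ∀ u v → A u v → A v u
  A-sym zero    (suc v) p = p
  A-sym (suc u) zero    p = p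
  A-sym (suc u) (suc v) p = symm G p

  A-irrefl : ∀ v → A v v → ⊥
  A-irrefl (suc v) p = irrefl G p

-- t-trees, one representative for each construction sequence; partial t-trees are
-- closed under isomorphism through the embedding below.
data IsTree (t : ℕ) : Graph → Set₁ where
  clique : IsTree t (complete t)
  extend : ∀ {G} → IsTree t G → (S : Subset (order G)) → IsClique G S → ∣ S ∣ ≡ t →
           IsTree t (addVertex G S)

-- Up to isomorphism, G is a (not necessarily induced) subgraph of H.
_IsSubgraphOf_ : Graph → Graph → Set
G IsSubgraphOf H = Σ (Vertex G → Vertex H) λ f →
  Injective _≡_ _≡_ f × (∀ {u v} → Adj G u v → Adj H (f u) (f v))

IsPartialTree : ℕ → Graph → Set₁
IsPartialTree t G = ∃[ H ] IsTree t H × G IsSubgraphOf H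

HasTreewidth : Graph → ℕ → Set₁
HasTreewidth G t = IsPartialTree t G × (∀ s → IsPartialTree s G → t ℕ.≤ s)

-- Each vertex gets b of the k colours, adjacent vertices getting disjoint sets.
Colouring : Graph → ℕ → ℕ → Set
Colouring G b k = Σ (Vertex G → Subset k) λ φ →
  (∀ v → ∣ φ v ∣ ≡ b) × (∀ {u v} → Adj G u v → Empty (φ u ∩ φ v))

-- k = χ_b(G)
IsMultichromatic : Graph → ℕ → ℕ → Set
IsMultichromatic G b k = Colouring G b k × (∀ j → Colouring G b j → k ℕ.≤ j)

-- x = χ_f(G) = inf { χ_b(G) / b : b ≥ 1 }, with b = suc a.
IsFractionalChromatic : Graph → ℝ → Set
IsFractionalChromatic G = IsInfimum λ y →
  ∃[ a ] ∃[ k ] IsMultichromatic G (suc a) k × y ≃ fromℚ (+ k ℚ./ suc a)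

{-# OPTIONS --safe #-}
module Submission where

-- Put d = t − ω and m = t − 2d. The universal graphs below contain every admissible
-- extension of every bag, so an adversary who knows the colouring can steer towards a bag
-- of t + 1 vertices which is the join of d + 1 nonadjacent pairs and m − 1 single vertices,
-- every pair having a small overlap of colours. The pairs are built one at a time. If q
-- further pairs are still to come, add a vertex u to the pairs already present, then q
-- preliminary pairs and a clique of m vertices, all of them nonadjacent to u. These m + 2q
-- vertices share the colours of u almost disjointly, so one of them, v, shares with u at
-- most (1 + q/m²)/(m + 2q) of its colours; forget the rest and keep the pair u, v.
-- Hence t + 1 − χ_f ≤ Σ_{q ≤ d} (1 + d/m²)/(m + 2q), and this sum is compared with the
-- logarithm by applying exp(w − a) ≥ (1 − a) exp w with a = 2/(m + 2q), since
-- ∏ (1 − a) telescopes to (m − 2)/t.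

-- Why q pairs and m single vertices: beside `u` and the i = d - q pairs already present, a bag has
-- room for m + 2q vertices, but they are joined to an i-clique, so at most ω - i = m + q of them
-- may be pairwise adjacent. Filling the room with m + q independent blocks takes q pairs. Averaging
-- over m + 2q vertices rather than m + q makes the denominators advance by 2, which is the origin
-- of the factor ½. A preliminary pair may share only b/m² of the b colours of `u`. Since m is at
-- least a fixed multiple of t, the relative error d/m² is then O(1/t); overlaps of size b/m would
-- leave an error that does not vanish. The moves of the adversary depend on the colouring, while
-- the graph must not. Each round therefore serves all legal requests at once, and the number of
-- rounds is the length of a play. A planted K_{t,t} makes the treewidth exactly t. The exponential
-- is available only as partial sums whose order is fixed before t, so the comparison with the
-- logarithm carries explicit error terms and follows a path of arguments that stays in a fixed
-- interval.

module Strategies where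

  open import Data.Bool.Base using (true; false)
  open import Data.Empty using (⊥-elim)
  open import Data.Fin.Base using (Fin; zero; suc)
  open import Data.Fin.Subset as Subset using (Subset; ∣_∣; _∩_; _─_; Empty; ⊤)
  open import Data.Fin.Subset.Properties using (x∈p∩q⁻; x∈p∩q⁺; p⊆q⇒∣p∣≤∣q∣; p─q⊆p; ∣⊤∣≡n; ∩-identityˡ)
  open import Data.List.Base using (List; []; _∷_; _++_; length; map)
  open import Data.List.Properties using (++-assoc; ++-identityʳ; length-++)
  open import Data.List.Membership.Propositional using (_∈_; _∉_)
  open import Data.List.Membership.Propositional.Properties using (∈-++⁺ˡ; ∈-++⁺ʳ; ∈-++⁻)
  open import Data.List.Relation.Binary.Subset.Propositional using (_⊆_)
  open import Data.List.Relation.Unary.All as All using (All; []; _∷_)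
  import Data.List.Relation.Unary.All.Properties as All
  open import Data.List.Relation.Unary.AllPairs using (AllPairs; []; _∷_)
  open import Data.List.Relation.Unary.Any using (here; there)
  open import Data.Nat.Base
  open import Data.Nat.ListAction using (sum)
  open import Data.Nat.Properties
  open import Data.Nat.Tactic.RingSolver using (solve-∀)
  open import Data.Product using (∃-syntax; _×_; _,_; proj₁; proj₂)
  open import Data.Sum using (inj₁; inj₂; [_,_]′)
  open import Data.Vec.Base as Vec using ([]; _∷_)
  open import Function using (_∘_; id)
  open import Relation.Binary.PropositionalEquality
  open import Relation.Nullary using (¬_)

  -- Cardinalities of colour sets, and averaging.

  ∣∩∣+∣─∣ : ∀ {n} (p q : Subset n) → ∣ p ∩ q ∣ + ∣ p ─ q ∣ ≡ ∣ p ∣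
  ∣∩∣+∣─∣ []          []          = refl
  ∣∩∣+∣─∣ (false ∷ p) (false ∷ q) = ∣∩∣+∣─∣ p q
  ∣∩∣+∣─∣ (false ∷ p) (true ∷ q)  = ∣∩∣+∣─∣ p q
  ∣∩∣+∣─∣ (true ∷ p)  (false ∷ q) =
    trans (+-suc ∣ p ∩ q ∣ ∣ p ─ q ∣) (cong suc (∣∩∣+∣─∣ p q))
  ∣∩∣+∣─∣ (true ∷ p)  (true ∷ q)  = cong suc (∣∩∣+∣─∣ p q)

  ∣∩∣-monoˡ : ∀ {n} {p p′ : Subset n} (q : Subset n) → p Subset.⊆ p′ → ∣ p ∩ q ∣ ≤ ∣ p′ ∩ q ∣
  ∣∩∣-monoˡ {p = p} q p⊆p′ = p⊆q⇒∣p∣≤∣q∣ λ x∈ →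
    let x∈p , x∈q = x∈p∩q⁻ p q x∈ in x∈p∩q⁺ (p⊆p′ x∈p , x∈q)

  ∣∩∣-split : ∀ {n} (p q r : Subset n) → ∣ p ∩ r ∣ ≡ ∣ (p ∩ q) ∩ r ∣ + ∣ (p ─ q) ∩ r ∣
  ∣∩∣-split []          []          []          = refl
  ∣∩∣-split (false ∷ p) (false ∷ q) (_ ∷ r)     = ∣∩∣-split p q r
  ∣∩∣-split (false ∷ p) (true ∷ q)  (_ ∷ r)     = ∣∩∣-split p q r
  ∣∩∣-split (true ∷ p)  (false ∷ q) (false ∷ r) = ∣∩∣-split p q r
  ∣∩∣-split (true ∷ p)  (true ∷ q)  (false ∷ r) = ∣∩∣-split p q r
  ∣∩∣-split (true ∷ p)  (false ∷ q) (true ∷ r)  =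
    trans (cong suc (∣∩∣-split p q r)) (sym (+-suc ∣ (p ∩ q) ∩ r ∣ ∣ (p ─ q) ∩ r ∣))
  ∣∩∣-split (true ∷ p)  (true ∷ q)  (true ∷ r)  = cong suc (∣∩∣-split p q r)

  Empty⇒∣p∣≡0 : ∀ {n} (p : Subset n) → Empty p → ∣ p ∣ ≡ 0
  Empty⇒∣p∣≡0 []          _ = refl
  Empty⇒∣p∣≡0 (true ∷ p)  e = ⊥-elim (e (zero , Vec.here))
  Empty⇒∣p∣≡0 (false ∷ p) e = Empty⇒∣p∣≡0 p λ (x , x∈p) → e (suc x , Vec.there x∈p)

  minimal-below-average : ∀ {V : Set} (f : V → ℕ) v vs →
    ∃[ w ] w ∈ v ∷ vs × length (v ∷ vs) * f w ≤ sum (map f (v ∷ vs))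
  minimal-below-average f v []       = v , here refl , ≤-refl
  minimal-below-average f v (x ∷ xs) with minimal-below-average f x xs
  ... | w , w∈ , avg with ≤-total (f v) (f w)
  ...   | inj₁ fv≤fw = v , here refl ,
          +-monoʳ-≤ (f v) (≤-trans (*-monoʳ-≤ (length (x ∷ xs)) fv≤fw) avg)
  ...   | inj₂ fw≤fv = w , there w∈ , +-mono-≤ fw≤fv avg

  -- A certificate for clique sizes: a clique meets each independent block at most once, so a clique
  -- inside the list has at most as many vertices as there are blocks. It licenses a new vertex
  -- adjacent to the whole list.
  data Cover {V : Set} (_~_ : V → V → Set) : List V → ℕ → Set where
    []    : Cover _~_ [] 0
    block : ∀ L {N q} → (∀ {u v} → u ∈ L → v ∈ L → ¬ u ~ v) → Cover _~_ N q →
            Cover _~_ (L ++ N) (suc q)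

  -- x is the number of colours shared by the pair built when q further pairs are to come.
  data Losses (m b : ℕ) : ℕ → ℕ → Set where
    []   : Losses m b 0 0
    step : ∀ {q s} x → m * m * ((m + (q + q)) * x) ≤ (m * m + q) * b →
           Losses m b q s → Losses m b (suc q) (x + s)

  -- A preliminary pair takes two cliques of `m` vertices; a stage adds `u` and one last `m`-clique
  -- as well. The argument `r` is what remains for the later stages, so that the index of a bag
  -- unfolds by computation as the moves are made.
  cost-rough cost-stage : ℕ → ℕ → ℕ → ℕ
  cost-rough m zero    r = r
  cost-rough m (suc q) r = m + (m + cost-rough m q r)
  cost-stage m q       r = suc (cost-rough m q (m + r))

  -- The number of vertices added while the last q pairs are built and the bag is completed.
  cost : ℕ → ℕ → ℕ
  cost m₀ zero    = m₀
  cost m₀ (suc q) = cost-stage (suc m₀) q (cost m₀ q)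

  -- Joins of independent blocks of size one or two, and the colours they use.

  module Tower {V : Set} (_~_ : V → V → Set)
    (~-sym : ∀ {u v} → u ~ v → v ~ u) (~-irrefl : ∀ {v} → ¬ v ~ v)
    where

    -- `X` holds the part of the bag to which every block must be joined as well; the colours of `X`
    -- do not enter the count below.
    data Tower (X : List V) : List V → ℕ → Set where
      []     : Tower X [] 0
      single : ∀ {v A q} → All (v ~_) A → All (v ~_) X → Tower X A q → Tower X (v ∷ A) (suc q)
      pair   : ∀ {u v A q} → ¬ u ~ v → All (u ~_) A → All (u ~_) X →
               All (v ~_) A → All (v ~_) X → Tower X A q → Tower X (u ∷ v ∷ A) (suc q)

    tower-cover : ∀ {X A q i} → Tower X A q → Cover _~_ X i → Cover _~_ (A ++ X) (q + i)
    tower-cover []                   c = c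
    tower-cover (single _ _ τ)       c =
      block (_ ∷ []) (λ { (here refl) (here refl) → ~-irrefl }) (tower-cover τ c)
    tower-cover (pair u≁v _ _ _ _ τ) c = block (_ ∷ _ ∷ [])
      (λ { (here refl)         (here refl)         → ~-irrefl
         ; (here refl)         (there (here refl)) → u≁v
         ; (there (here refl)) (here refl)         → u≁v ∘ ~-sym
         ; (there (here refl)) (there (here refl)) → ~-irrefl })
      (tower-cover τ c)

    tower-adjacent : ∀ {X A q v} → Tower X A q → v ∈ A → All (v ~_) X
    tower-adjacent (single _ a _)     (here refl)         = a
    tower-adjacent (single _ _ τ)     (there v∈)          = tower-adjacent τ v∈
    tower-adjacent (pair _ _ a _ _ _) (here refl)         = a
    tower-adjacent (pair _ _ _ _ a _) (there (here refl)) = a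
    tower-adjacent (pair _ _ _ _ _ τ) (there (there v∈))  = tower-adjacent τ v∈

    append : ∀ {X A B p q} → Tower (A ++ X) B p → Tower X A q → Tower X (B ++ A) (p + q)
    append         []                     τ = τ
    append {A = A} (single b ax σ)        τ =
      single (All.++⁺ b (All.++⁻ˡ A ax)) (All.++⁻ʳ A ax) (append σ τ)
    append {A = A} (pair u≁v b ax c ay σ) τ =
      pair u≁v (All.++⁺ b (All.++⁻ˡ A ax)) (All.++⁻ʳ A ax)
               (All.++⁺ c (All.++⁻ˡ A ay)) (All.++⁻ʳ A ay) (append σ τ)

    module Measure {b k : ℕ} (φ : V → Subset k)
      (∣φ∣≡b : ∀ v → ∣ φ v ∣ ≡ b) (φ-disjoint : ∀ {u v} → u ~ v → Empty (φ u ∩ φ v))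
      where

      load : Subset k → List V → ℕ
      load M A = sum (map (λ v → ∣ M ∩ φ v ∣) A)

      excess : ∀ {X A q} → Subset k → Tower X A q → ℕ
      excess M []                           = 0
      excess M (single _ _ τ)               = excess M τ
      excess M (pair {u} {v} _ _ _ _ _ τ) = ∣ (M ∩ φ u) ∩ φ v ∣ + excess M τ

      excess-append : ∀ {X A B p q} M (σ : Tower (A ++ X) B p) (τ : Tower X A q) →
        excess M (append σ τ) ≡ excess M σ + excess M τ
      excess-append M []                 τ = refl
      excess-append M (single _ _ σ)     τ = excess-append M σ τ
      excess-append M (pair {u} {v} _ _ _ _ _ σ) τ =
        trans (cong (∣ (M ∩ φ u) ∩ φ v ∣ +_) (excess-append M σ τ))
              (sym (+-assoc ∣ (M ∩ φ u) ∩ φ v ∣ (excess M σ) (excess M τ)))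

      excess-mono : ∀ {X A q M M′} (τ : Tower X A q) → M Subset.⊆ M′ → excess M τ ≤ excess M′ τ
      excess-mono []             _    = z≤n
      excess-mono (single _ _ τ) M⊆M′ = excess-mono τ M⊆M′
      excess-mono {M = M} (pair {u} {v} _ _ _ _ _ τ) M⊆M′ = +-mono-≤
        (∣∩∣-monoˡ (φ v) λ x∈ → let p , q = x∈p∩q⁻ M (φ u) x∈ in x∈p∩q⁺ (M⊆M′ p , q))
        (excess-mono τ M⊆M′)

      load-remove : ∀ {u} M A → All (u ~_) A → load M A ≡ load (M ─ φ u) A
      load-remove {u} M []      []        = refl
      load-remove {u} M (v ∷ A) (u~v ∷ a) = cong₂ _+_
        (trans (∣∩∣-split M (φ u) (φ v))
               (cong (_+ ∣ (M ─ φ u) ∩ φ v ∣) (Empty⇒∣p∣≡0 _ λ (x , x∈) →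
                 let x∈Mu , x∈v = x∈p∩q⁻ (M ∩ φ u) (φ v) x∈
                 in φ-disjoint u~v (x , x∈p∩q⁺ (proj₂ (x∈p∩q⁻ M (φ u) x∈Mu) , x∈v)))))
        (load-remove M A a)

      -- Different blocks have disjoint colour sets, so a colour of `M` is counted once, or twice if
      -- it lies in the overlap of a pair. The induction deletes the colours of the first block from
      -- `M`, which leaves the load of the other blocks unchanged.
      load≤ : ∀ {X A q} M (τ : Tower X A q) → load M A ≤ ∣ M ∣ + excess M τ
      load≤ M []             = z≤n
      load≤ {A = v ∷ A} M (single a _ τ) = begin
        ∣ M ∩ φ v ∣ + load M A                                ≡⟨ cong (∣ M ∩ φ v ∣ +_) (load-remove M A a) ⟩
        ∣ M ∩ φ v ∣ + load (M ─ φ v) A                        ≤⟨ +-monoʳ-≤ ∣ M ∩ φ v ∣ (load≤ (M ─ φ v) τ) ⟩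
        ∣ M ∩ φ v ∣ + (∣ M ─ φ v ∣ + excess (M ─ φ v) τ)
          ≤⟨ +-monoʳ-≤ ∣ M ∩ φ v ∣ (+-monoʳ-≤ ∣ M ─ φ v ∣ (excess-mono τ (p─q⊆p M (φ v)))) ⟩
        ∣ M ∩ φ v ∣ + (∣ M ─ φ v ∣ + excess M τ)              ≡⟨ +-assoc ∣ M ∩ φ v ∣ ∣ M ─ φ v ∣ _ ⟨
        ∣ M ∩ φ v ∣ + ∣ M ─ φ v ∣ + excess M τ                ≡⟨ cong (_+ excess M τ) (∣∩∣+∣─∣ M (φ v)) ⟩
        ∣ M ∣ + excess M τ                                    ∎
        where open ≤-Reasoning
      load≤ {A = u ∷ v ∷ A} M (pair _ a _ c _ τ) = begin
        x + (∣ M ∩ φ v ∣ + load M A)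
          ≡⟨ cong₂ (λ y z → x + (y + z)) (∣∩∣-split M (φ u) (φ v))
               (trans (load-remove M A a) (load-remove (M ─ φ u) A c)) ⟩
        x + (o + y + load M′ A)
          ≤⟨ +-monoʳ-≤ x (+-monoʳ-≤ (o + y) (≤-trans (load≤ M′ τ) (+-monoʳ-≤ ∣ M′ ∣
               (excess-mono τ (p─q⊆p M (φ u) ∘ p─q⊆p (M ─ φ u) (φ v)))))) ⟩
        x + (o + y + (∣ M′ ∣ + excess M τ))
          ≡⟨ shuffle x o y ∣ M′ ∣ (excess M τ) ⟩
        x + (y + ∣ M′ ∣) + (o + excess M τ)
          ≡⟨ cong (λ z → x + z + (o + excess M τ)) (∣∩∣+∣─∣ (M ─ φ u) (φ v)) ⟩
        x + ∣ M ─ φ u ∣ + (o + excess M τ)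
          ≡⟨ cong (_+ (o + excess M τ)) (∣∩∣+∣─∣ M (φ u)) ⟩
        ∣ M ∣ + (o + excess M τ) ∎
        where
        open ≤-Reasoning
        M′ = (M ─ φ u) ─ φ v
        x = ∣ M ∩ φ u ∣
        y = ∣ (M ─ φ u) ∩ φ v ∣
        o = ∣ (M ∩ φ u) ∩ φ v ∣
        shuffle : ∀ x o y z e → x + (o + y + (z + e)) ≡ x + (y + z) + (o + e)
        shuffle = solve-∀

      load-⊤ : ∀ A → load ⊤ A ≡ length A * b
      load-⊤ []      = refl
      load-⊤ (v ∷ A) = cong₂ _+_ (trans (cong ∣_∣ (∩-identityˡ (φ v))) (∣φ∣≡b v)) (load-⊤ A)

    -- The game in abstract form: `Bag r P` says that the vertices `P` lie in a common bag and that
    -- `r` rounds remain. A move adds a vertex adjacent to `N` and to nothing in `M`; it needs a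
    -- free place in the bag and a cover of `N` by fewer than `ω` independent blocks.
    module Strategy (t ω : ℕ) (Bag : ℕ → List V → Set₁)
      (shrink : ∀ {r P Q} → Bag r P → Q ⊆ P → Bag r Q)
      (add : ∀ {r q} N M → Bag (suc r) (N ++ M) → length (N ++ M) ≤ t → Cover _~_ N q → q < ω →
         All (_∉ N) M →
         ∃[ v ] Bag r (v ∷ N ++ M) × All (v ~_) N × All (λ w → ¬ v ~ w) M × All (v ≢_) (N ++ M))
      where

      record Added (r : ℕ) (N M : List V) (m : ℕ) : Set₁ where
        field
          ws       : List V
          tower    : Tower N ws m
          length≡  : length ws ≡ m
          pairwise : AllPairs _~_ ws
          bag      : Bag r (ws ++ N ++ M)
          apart    : ∀ {w} → w ∈ ws → All (λ u → ¬ w ~ u × w ≢ u) M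
          -- No block is a pair; colourings are fixed only after the graph is built.
          thin     : ∀ {b k} φ (∣φ∣≡b : ∀ v → ∣ φ v ∣ ≡ b)
                     (φ-disjoint : ∀ {u v} → u ~ v → Empty (φ u ∩ φ v)) → ∀ S → Measure.excess {b} {k} φ ∣φ∣≡b φ-disjoint S tower ≡ 0

      abstract
        -- Each new vertex is joined to `N` and to the clique built so far, which adds one singleton
        -- block to the cover; `m + q ≤ ω` keeps the last move legal. The total may reach t + 1, as
        -- a move needs only one place left.
        add-many : ∀ m {r q} N M → Bag (m + r) (N ++ M) → length (N ++ M) + m ≤ suc t →
          Cover _~_ N q → m + q ≤ ω → All (_∉ N) M → Added r N M m
        add-many zero    N M bag _ _ _ _ = record
          { ws = [] ; tower = [] ; length≡ = refl ; pairwise = [] ; bag = bag ; apart = λ ()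
          ; thin = λ _ _ _ _ → refl }
        add-many (suc m) {r} {q} N M bag fits c small M∉N
          with add-many m {suc r} N M (subst (λ s → Bag s (N ++ M)) (sym (+-suc m r)) bag)
                 (≤-trans (+-monoʳ-≤ (length (N ++ M)) (n≤1+n m)) fits) c (≤-trans (n≤1+n _) small) M∉N
        ... | record { ws = ws ; tower = τ ; length≡ = len ; pairwise = ps ; bag = bag′ ; apart = apart ; thin = thin }
          with add (ws ++ N) M (subst (Bag (suc r)) (sym (++-assoc ws N M)) bag′) fits′
                 (tower-cover τ c) small
                 (All.tabulate λ {w} w∈M w∈ → [ (λ w∈ws → proj₂ (All.lookup (apart w∈ws) w∈M) refl)
                                              , All.lookup M∉N w∈M ]′ (∈-++⁻ ws w∈))
          where
          fits′ : length ((ws ++ N) ++ M) ≤ t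
          fits′ = s≤s⁻¹ (≤-trans (≤-reflexive eq) fits)
            where
            eq : suc (length ((ws ++ N) ++ M)) ≡ length (N ++ M) + suc m
            eq = begin
              suc (length ((ws ++ N) ++ M))       ≡⟨ cong (suc ∘ length) (++-assoc ws N M) ⟩
              suc (length (ws ++ N ++ M))         ≡⟨ cong suc (length-++ ws) ⟩
              suc (length ws + length (N ++ M))   ≡⟨ cong (λ l → suc (l + length (N ++ M))) len ⟩
              suc (m + length (N ++ M))           ≡⟨ +-comm (suc m) _ ⟩
              length (N ++ M) + suc m             ∎
              where open ≡-Reasoning
        ...   | v , bag″ , v~ , v≁ , v≢ = record
          { ws      = v ∷ ws
          ; tower   = single (All.++⁻ˡ ws v~) (All.++⁻ʳ ws v~) τ
          ; length≡ = cong suc len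
          ; pairwise = All.++⁻ˡ ws v~ ∷ ps
          ; bag     = subst (Bag r) (cong (v ∷_) (++-assoc ws N M)) bag″
          ; apart   = λ { (here refl) → All.zipWith id (v≁ , All.++⁻ʳ (ws ++ N) v≢)
                        ; (there w∈)  → apart w∈ }
          ; thin    = thin
          }

      -- The adversary against a fixed colouring.

      module Play {b k : ℕ} (φ : V → Subset k)
        (∣φ∣≡b : ∀ v → ∣ φ v ∣ ≡ b) (φ-disjoint : ∀ {u v} → u ~ v → Empty (φ u ∩ φ v))
        (m₀ d : ℕ) (t≡ : t ≡ suc m₀ + (d + d)) (ω≡ : ω ≡ suc m₀ + d)
        where

        m : ℕ
        m = suc m₀

        open Measure {b} {k} φ ∣φ∣≡b φ-disjoint

        -- The colour sets of a clique are disjoint, so its `m` shares of `S` add up to at most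
        -- `∣ S ∣`.
        choose : ∀ {r N M} (S : Subset k) (A : Added r N M m) →
          ∃[ w ] w ∈ Added.ws A × m * ∣ S ∩ φ w ∣ ≤ ∣ S ∣
        choose S record { ws = v ∷ vs ; tower = τ ; length≡ = refl ; thin = thin }
          with minimal-below-average (λ w → ∣ S ∩ φ w ∣) v vs
        ... | w , w∈ , avg = w , w∈ , (begin
          m * ∣ S ∩ φ w ∣    ≤⟨ avg ⟩
          load S (v ∷ vs)    ≤⟨ load≤ S τ ⟩
          ∣ S ∣ + excess S τ ≡⟨ cong (∣ S ∣ +_) (thin φ ∣φ∣≡b φ-disjoint S) ⟩
          ∣ S ∣ + 0          ≡⟨ +-identityʳ ∣ S ∣ ⟩
          ∣ S ∣              ∎)
          where open ≤-Reasoning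

        -- The preliminary pairs. Overlaps are measured inside `φ u` only, because it is the colours
        -- of `u` that are shared out when the partner of `u` is chosen.
        record Rough (X : List V) (u : V) (Y : List V) (l : ℕ) : Set where
          field
            tower   : Tower X Y l
            length≡ : length Y ≡ l + l
            apart   : ∀ {y} → y ∈ Y → ¬ y ~ u × y ≢ u
            thin    : m * m * excess (φ u) tower ≤ l * b

        -- With n < d pairs present there are still two places beside an `m`-clique; `e` counts the
        -- vertices held in them, `u` alone or `a` and `u`.
        room : ∀ n e {l} → l ≡ n + n → e ≤ 2 → n < d → l + e + m ≤ suc t
        room n e {l} refl e≤2 n<d = begin
          n + n + e + m           ≤⟨ +-monoˡ-≤ m (+-monoʳ-≤ (n + n) e≤2) ⟩
          n + n + 2 + m           ≡⟨ cong (_+ m) (trans (+-comm (n + n) 2) (cong suc (sym (+-suc n n)))) ⟩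
          suc n + suc n + m       ≤⟨ +-monoˡ-≤ m (+-mono-≤ n<d n<d) ⟩
          d + d + m               ≡⟨ +-comm (d + d) m ⟩
          m + (d + d)             ≡⟨ t≡ ⟨
          t                       ≤⟨ n≤1+n t ⟩
          suc t                   ∎
          where open ≤-Reasoning

        module Thicken {X u Y l i r} (R : Rough X u Y l) (u∉X : u ∉ X) (c : Cover _~_ X i)
          (len-X : length X ≡ i + i) (l+i<d : l + i < d)
          (bag₀ : Bag (m + (m + r)) ((Y ++ X) ++ u ∷ []))
          where

          open Rough R

          N : List V
          N = Y ++ X

          u∉N : u ∉ N
          u∉N u∈ = [ (λ u∈Y → proj₂ (apart u∈Y) refl) , u∉X ]′ (∈-++⁻ Y u∈)

          cN : Cover _~_ N (l + i)
          cN = tower-cover tower c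

          small : m + (l + i) ≤ ω
          small = subst (m + (l + i) ≤_) (sym ω≡) (+-monoʳ-≤ m (<⇒≤ l+i<d))

          len-N : length N ≡ (l + i) + (l + i)
          len-N = trans (length-++ Y) (trans (cong₂ _+_ length≡ len-X) (+-middle l l i i))
            where
            +-middle : ∀ a b c d → (a + b) + (c + d) ≡ (a + c) + (b + d)
            +-middle = solve-∀

          fits : ∀ M → length M ≤ 2 → length (N ++ M) + m ≤ suc t
          fits M M≤2 = subst (λ n → n + m ≤ suc t) (sym (length-++ N))
            (room (l + i) (length M) len-N M≤2 l+i<d)

          first : Added (m + r) N (u ∷ []) m
          first = add-many m N (u ∷ []) bag₀ (fits (u ∷ []) (s≤s z≤n)) cN small (u∉N ∷ [])

          open Added first using () renaming (ws to as; tower to τ₁; bag to bag₁; apart to apart₁)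

          module Second (a : V) (a∈ : a ∈ as) (ma≤ : m * ∣ φ u ∩ φ a ∣ ≤ ∣ φ u ∣) where

            a~N : All (a ~_) N
            a~N = tower-adjacent τ₁ a∈

            bag₁′ : Bag (m + r) (N ++ a ∷ u ∷ [])
            bag₁′ = shrink bag₁ λ x∈ → [ (λ x∈N → ∈-++⁺ʳ as (∈-++⁺ˡ x∈N))
                                       , (λ { (here refl)         → ∈-++⁺ˡ a∈
                                            ; (there (here refl)) → ∈-++⁺ʳ as (∈-++⁺ʳ N (here refl)) }) ]′
                                       (∈-++⁻ N x∈)

            -- Listing `a` among the avoided vertices makes the second clique nonadjacent to both
            -- `a` and `u`, so any of its vertices completes a pair with `a`.
            next : Added r N (a ∷ u ∷ []) m
            next = add-many m N (a ∷ u ∷ []) bag₁′ (fits (a ∷ u ∷ []) ≤-refl) cN small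
              ((λ a∈N → ~-irrefl (All.lookup a~N a∈N)) ∷ u∉N ∷ [])

            open Added next using () renaming (ws to bs; tower to τ₂; bag to bag₂; apart to apart₂)

            module Third (a′ : V) (a′∈ : a′ ∈ bs)
              (ma′≤ : m * ∣ (φ u ∩ φ a) ∩ φ a′ ∣ ≤ ∣ φ u ∩ φ a ∣) where

              a′~N : All (a′ ~_) N
              a′~N = tower-adjacent τ₂ a′∈

              o : ℕ
              o = ∣ (φ u ∩ φ a) ∩ φ a′ ∣

              tower′ : Tower X (a ∷ a′ ∷ Y) (suc l)
              tower′ = pair (proj₁ (All.lookup (apart₂ a′∈) (here refl)) ∘ ~-sym)
                (All.++⁻ˡ Y a~N) (All.++⁻ʳ Y a~N) (All.++⁻ˡ Y a′~N) (All.++⁻ʳ Y a′~N) tower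

              mmo≤b : m * m * o ≤ b
              mmo≤b = begin
                m * m * o               ≡⟨ *-assoc m m o ⟩
                m * (m * o)             ≤⟨ *-monoʳ-≤ m ma′≤ ⟩
                m * ∣ φ u ∩ φ a ∣       ≤⟨ ma≤ ⟩
                ∣ φ u ∣                 ≡⟨ ∣φ∣≡b u ⟩
                b                       ∎
                where open ≤-Reasoning

              apart′ : ∀ {y} → y ∈ a ∷ a′ ∷ Y → ¬ y ~ u × y ≢ u
              apart′ (here refl)         = All.lookup (apart₁ a∈) (here refl)
              apart′ (there (here refl)) = All.lookup (apart₂ a′∈) (there (here refl))
              apart′ (there (there y∈))  = apart y∈

              rough′ : Rough X u (a ∷ a′ ∷ Y) (suc l)
              rough′ = record
                { tower   = tower′
                ; length≡ = trans (cong (λ n → suc (suc n)) length≡) (cong suc (sym (+-suc l l)))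
                ; apart   = apart′
                ; thin    = ≤-trans (≤-reflexive (*-distribˡ-+ (m * m) o (excess (φ u) tower)))
                                    (+-mono-≤ mmo≤b thin)
                }

              bag′ : Bag r ((a ∷ a′ ∷ Y ++ X) ++ u ∷ [])
              bag′ = shrink bag₂ λ
                { (here refl)         → ∈-++⁺ʳ bs (∈-++⁺ʳ N (here refl))
                ; (there (here refl)) → ∈-++⁺ˡ a′∈
                ; (there (there x∈))  → [ (λ x∈N → ∈-++⁺ʳ bs (∈-++⁺ˡ x∈N))
                                        , (λ { (here refl) → ∈-++⁺ʳ bs (∈-++⁺ʳ N (there (here refl))) }) ]′
                                        (∈-++⁻ N x∈) }

            pairing : ∃[ Y′ ] Rough X u Y′ (suc l) × Bag r ((Y′ ++ X) ++ u ∷ [])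
            pairing = let a′ , a′∈ , ma′≤ = choose (φ u ∩ φ a) next
                          open Third a′ a′∈ ma′≤
                      in _ , rough′ , bag′

          -- Choosing the new pair one vertex at a time, each from a fresh m-clique, gains a
          -- factor m twice.
          thicken : ∃[ Y′ ] Rough X u Y′ (suc l) × Bag r ((Y′ ++ X) ++ u ∷ [])
          thicken = let a , a∈ , ma≤ = choose (φ u) first in Second.pairing a a∈ ma≤

        abstract
          roughs : ∀ q {X u Y l i r} → Rough X u Y l → u ∉ X → Cover _~_ X i → length X ≡ i + i →
            q + (l + i) ≤ d → Bag (cost-rough m q r) ((Y ++ X) ++ u ∷ []) →
            ∃[ Y′ ] Rough X u Y′ (q + l) × Bag r ((Y′ ++ X) ++ u ∷ [])
          roughs zero    {Y = Y}              R _   _ _   _       bag = Y , R , bag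
          roughs (suc q) {X} {u} {Y} {l} {i} {r} R u∉X c len q+l+i≤d bag =
            let Y′ , R′ , bag′ = Thicken.thicken R u∉X c len (≤-trans (s≤s (m≤n+m (l + i) q)) q+l+i≤d) bag
                Y″ , R″ , bag″ = roughs q R′ u∉X c len (subst (_≤ d) (sym (+-suc q (l + i))) q+l+i≤d) bag′
            in Y″ , subst (Rough X u Y″) (+-suc q l) R″ , bag″

        record Extended (r : ℕ) (X : List V) (q : ℕ) : Set₁ where
          field
            u v   : V
            u~X   : All (u ~_) X
            v~X   : All (v ~_) X
            u≁v   : ¬ u ~ v
            bag   : Bag r (u ∷ v ∷ X)
            small : m * m * ((m + (q + q)) * ∣ φ u ∩ φ v ∣) ≤ (m * m + q) * b

        module Stage (q : ℕ) {X : List V} {i r : ℕ} (c : Cover _~_ X i) (len-X : length X ≡ i + i) (q+i≡d : q + i ≡ d) where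

          module Partner {u Y} (u~X : All (u ~_) X) (R : Rough X u Y q)
            (bag₀ : Bag (m + r) ((Y ++ X) ++ u ∷ [])) where

            open Rough R

            u∉N : u ∉ Y ++ X
            u∉N u∈ = [ (λ u∈Y → proj₂ (apart u∈Y) refl)
                     , (λ u∈X → ~-irrefl (All.lookup u~X u∈X)) ]′ (∈-++⁻ Y u∈)

            -- Here the bag becomes full: i pairs, `u`, q preliminary pairs and m single vertices
            -- are exactly t + 1 vertices. The clique bound is exhausted too, since m + q + i = ω.
            fits : length ((Y ++ X) ++ u ∷ []) + m ≡ suc t
            fits = begin
              length ((Y ++ X) ++ u ∷ []) + m       ≡⟨ cong (_+ m) (length-++ (Y ++ X)) ⟩
              length (Y ++ X) + 1 + m               ≡⟨ cong (λ n → n + 1 + m) (length-++ Y) ⟩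
              length Y + length X + 1 + m           ≡⟨ cong₂ (λ x y → x + y + 1 + m) length≡ len-X ⟩
              (q + q) + (i + i) + 1 + m             ≡⟨ shuffle q i m ⟩
              suc (m + ((q + i) + (q + i)))         ≡⟨ cong (λ n → suc (m + (n + n))) q+i≡d ⟩
              suc (m + (d + d))                     ≡⟨ cong suc t≡ ⟨
              suc t                                 ∎
              where
              open ≡-Reasoning
              shuffle : ∀ q i m → (q + q) + (i + i) + 1 + m ≡ suc (m + ((q + i) + (q + i)))
              shuffle = solve-∀

            added : Added r (Y ++ X) (u ∷ []) m
            added = add-many m (Y ++ X) (u ∷ []) bag₀ (≤-reflexive fits) (tower-cover tower c)
              (≤-reflexive (trans (cong (m +_) q+i≡d) (sym ω≡))) (u∉N ∷ [])

            open Added added using (ws) renaming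
              (tower to σ; length≡ to len-ws; bag to bag₁; apart to apart₁; thin to thin₁)

            whole : Tower X (ws ++ Y) (m + q)
            whole = append σ tower

            thin-whole : m * m * excess (φ u) whole ≤ q * b
            thin-whole = subst (λ e → m * m * e ≤ q * b)
              (sym (trans (excess-append (φ u) σ tower)
                          (cong (_+ excess (φ u) tower) (thin₁ φ ∣φ∣≡b φ-disjoint (φ u))))) thin

            length-whole : length (ws ++ Y) ≡ m + (q + q)
            length-whole = trans (length-++ ws) (cong₂ _+_ len-ws length≡)

            -- By `load≤` with `M` taken to be `φ u`, all these vertices together use the colours of
            -- `u` at most b + qb/m² times; the factor m² only clears denominators.
            choose-v : ∀ {A} (τ : Tower X A (m + q)) → m * m * excess (φ u) τ ≤ q * b →
              length A ≡ m + (q + q) →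
              ∃[ v ] v ∈ A × m * m * ((m + (q + q)) * ∣ φ u ∩ φ v ∣) ≤ (m * m + q) * b
            choose-v {x ∷ xs} τ thin-τ len =
              let v , v∈ , avg = minimal-below-average (λ w → ∣ φ u ∩ φ w ∣) x xs
              in v , v∈ , (begin
                m * m * ((m + (q + q)) * ∣ φ u ∩ φ v ∣)   ≡⟨ cong (λ n → m * m * (n * ∣ φ u ∩ φ v ∣)) len ⟨
                m * m * (length (x ∷ xs) * ∣ φ u ∩ φ v ∣) ≤⟨ *-monoʳ-≤ (m * m) (≤-trans avg (load≤ (φ u) τ)) ⟩
                m * m * (∣ φ u ∣ + excess (φ u) τ)        ≡⟨ *-distribˡ-+ (m * m) ∣ φ u ∣ _ ⟩
                m * m * ∣ φ u ∣ + m * m * excess (φ u) τ  ≤⟨ +-monoʳ-≤ (m * m * ∣ φ u ∣) thin-τ ⟩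
                m * m * ∣ φ u ∣ + q * b                   ≡⟨ cong (λ n → m * m * n + q * b) (∣φ∣≡b u) ⟩
                m * m * b + q * b                         ≡⟨ *-distribʳ-+ b (m * m) q ⟨
                (m * m + q) * b                           ∎)
              where open ≤-Reasoning

            nonadjacent : ∀ {v} → v ∈ ws ++ Y → ¬ u ~ v
            nonadjacent v∈ = [ (λ v∈ws → proj₁ (All.lookup (apart₁ v∈ws) (here refl)))
                             , (λ v∈Y → proj₁ (apart v∈Y)) ]′ (∈-++⁻ ws v∈) ∘ ~-sym

            bag₂ : ∀ {v} → v ∈ ws ++ Y → Bag r (u ∷ v ∷ X)
            bag₂ v∈ = shrink bag₁ λ
              { (here refl)         → ∈-++⁺ʳ ws (∈-++⁺ʳ (Y ++ X) (here refl))
              ; (there (here refl)) → [ ∈-++⁺ˡ , (λ v∈Y → ∈-++⁺ʳ ws (∈-++⁺ˡ (∈-++⁺ˡ v∈Y))) ]′ (∈-++⁻ ws v∈)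
              ; (there (there x∈))  → ∈-++⁺ʳ ws (∈-++⁺ˡ (∈-++⁺ʳ Y x∈)) }

            extended : Extended r X q
            extended = let v , v∈ , small = choose-v whole thin-whole length-whole in record
              { u = u ; v = v ; u~X = u~X ; v~X = tower-adjacent whole v∈
              ; u≁v = nonadjacent v∈ ; bag = bag₂ v∈ ; small = small }

          X++[]≡X : X ++ [] ≡ X
          X++[]≡X = ++-identityʳ X

          i≤d : i ≤ d
          i≤d = subst (i ≤_) q+i≡d (m≤n+m i q)

          abstract
            stage : Bag (cost-stage m q r) X → Extended r X q
            stage bag₀ =
              let
                u , bag₁ , u~X , _ = add {cost-rough m q (m + r)} X []
                  (subst (Bag (cost-stage m q r)) (sym X++[]≡X) bag₀) fits c
                  (subst (i <_) (sym ω≡) (s≤s (≤-trans i≤d (m≤n+m d m₀)))) []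
                Y , R , bag₂ = roughs q {X} {u} {[]} {0}
                  record { tower = [] ; length≡ = refl ; apart = λ () ; thin = ≤-reflexive (*-zeroʳ (m * m)) }
                  (λ u∈X → ~-irrefl (All.lookup u~X u∈X)) c len-X (≤-reflexive q+i≡d)
                  (shrink bag₁ λ x∈ → [ (λ x∈X → there (∈-++⁺ˡ x∈X)) , (λ { (here refl) → here refl }) ]′
                                      (∈-++⁻ X x∈))
              in Partner.extended u~X (subst (Rough X u Y) (+-identityʳ q) R) bag₂
              where
              fits : length (X ++ []) ≤ t
              fits = begin
                length (X ++ []) ≡⟨ cong length X++[]≡X ⟩
                length X         ≡⟨ len-X ⟩
                i + i            ≤⟨ +-mono-≤ i≤d i≤d ⟩
                d + d            ≤⟨ m≤n+m (d + d) m ⟩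
                m + (d + d)      ≡⟨ t≡ ⟨
                t                ∎
                where open ≤-Reasoning

        abstract
          -- The d + 1 pairs and m - 1 further single vertices fill a bag with t + 1 vertices in ω
          -- blocks. Each vertex has b colours, so b(t + 1) exceeds the number of colours by at most
          -- the overlaps of the pairs.
          finish : ∀ {X} (τ : Tower [] X (suc d)) → length X ≡ suc d + suc d → Bag m₀ X →
            b * suc t ≤ k + excess ⊤ τ
          finish {X} τ len bag = begin
            b * suc t                          ≡⟨ *-comm b (suc t) ⟩
            suc t * b                          ≡⟨ cong (_* b) length-all ⟨
            length (ws ++ X) * b               ≡⟨ load-⊤ (ws ++ X) ⟨
            load ⊤ (ws ++ X)                   ≤⟨ load≤ ⊤ (append σ τ) ⟩
            ∣ ⊤ {k} ∣ + excess ⊤ (append σ τ)  ≡⟨ cong₂ _+_ (∣⊤∣≡n k) (excess-append ⊤ σ τ) ⟩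
            k + (excess ⊤ σ + excess ⊤ τ)      ≡⟨ cong (λ e → k + (e + excess ⊤ τ)) (thin₁ φ ∣φ∣≡b φ-disjoint ⊤) ⟩
            k + excess ⊤ τ                     ∎
            where
            open ≤-Reasoning
            X++[]++[]≡X : (X ++ []) ++ [] ≡ X
            X++[]++[]≡X = trans (++-identityʳ (X ++ [])) (++-identityʳ X)
            small : m₀ + (suc d + 0) ≡ ω
            small = trans (cong (m₀ +_) (+-identityʳ (suc d))) (trans (+-suc m₀ d) (sym ω≡))
            length-X+m₀ : length X + m₀ ≡ suc t
            length-X+m₀ = trans (cong (_+ m₀) len) (trans (shuffle d m₀) (cong suc (sym t≡)))
              where
              shuffle : ∀ d m₀ → suc d + suc d + m₀ ≡ suc (suc m₀ + (d + d))
              shuffle = solve-∀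
            added : Added 0 (X ++ []) [] m₀
            added = add-many m₀ (X ++ []) []
              (subst₂ Bag (sym (+-identityʳ m₀)) (sym X++[]++[]≡X) bag)
              (≤-reflexive (trans (cong (λ X → length X + m₀) X++[]++[]≡X) length-X+m₀))
              (tower-cover τ []) (≤-reflexive small) []
            open Added added using (ws) renaming (tower to σ; length≡ to len-ws; thin to thin₁)
            length-all : length (ws ++ X) ≡ suc t
            length-all = trans (length-++ ws) (trans (+-comm (length ws) (length X))
              (trans (cong (length X +_) len-ws) length-X+m₀))

          -- While the next pair is built, one fewer pair is still to come, so `Stage` is entered
          -- with q + i = d. Overlaps of pairs already built stay in `excess ⊤ τ`, those of later
          -- pairs go into `s`.
          stages : ∀ q {X i} (τ : Tower [] X i) → length X ≡ i + i → q + i ≡ suc d → Bag (cost m₀ q) X →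
            ∃[ s ] Losses m b q s × b * suc t ≤ k + (excess ⊤ τ + s)
          stages zero τ len refl bag = 0 , [] ,
            subst (λ e → b * suc t ≤ k + e) (sym (+-identityʳ (excess ⊤ τ))) (finish τ len bag)
          stages (suc q) {X} {i} τ len q+i≡1+d bag =
            let s , losses , bound = stages q {i = suc i} (pair u≁v u~X [] v~X [] τ)
                  (trans (cong (λ n → suc (suc n)) len) (cong suc (sym (+-suc i i))))
                  (trans (+-suc q i) q+i≡1+d) bag′
            in x + s , step x small losses , subst (λ e → b * suc t ≤ k + e) (eq s) bound
            where
            cover : Cover _~_ X i
            cover = subst₂ (Cover _~_) (++-identityʳ X) (+-identityʳ i) (tower-cover τ [])
            open Extended (Stage.stage q {X} {i} {cost m₀ q} cover len (suc-injective q+i≡1+d) bag)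
              renaming (bag to bag′)
            x : ℕ
            x = ∣ φ u ∩ φ v ∣
            eq : ∀ s → ∣ (⊤ ∩ φ u) ∩ φ v ∣ + excess ⊤ τ + s ≡ excess ⊤ τ + (x + s)
            eq s = trans (cong (λ p → ∣ p ∩ φ v ∣ + excess ⊤ τ + s) (∩-identityˡ (φ u)))
                         (shuffle x (excess ⊤ τ) s)
              where
              shuffle : ∀ x e s → x + e + s ≡ e + (x + s)
              shuffle = solve-∀

-- Partial t-trees of clique number ω that contain every play.

module UniversalGraphs where

  open Strategies
  open import Defs using (Graph; order; Adj; adj?; symm; irrefl; Vertex; IsClique; IsCliqueNumber;
    complete; addVertex; IsTree; clique; extend; HasTreewidth; Colouring)
  open import Data.Bool.Base using (true; false)
  open import Data.Empty using (⊥; ⊥-elim)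
  open import Data.Fin.Base using (Fin; zero; suc; punchIn; punchOut; toℕ; cast)
  open import Data.Fin.Properties using (_≟_; any?; all?; suc-injective; injective⇒≤;
    punchIn-injective; punchIn-punchOut; toℕ-injective; toℕ-cast)
  open import Data.Fin.Subset as Subset using (Subset; ∣_∣; outside; ⁅_⁆; _∪_; _-_; ⊤)
    renaming (_∈_ to _∈ₛ_; _∉_ to _∉ₛ_; _⊆_ to _⊆ₛ_)
  open import Data.Fin.Subset.Properties as Subset using (_⊆?_; anySubset?; drop-there; x∈⁅x⁆;
    x∈⁅y⁆⇒x≡y; x∈p∪q⁻; x∈p∪q⁺; ∉⊥; ∣⊥∣≡0; ∣⊤∣≡n; ∈⊤; p⊆q⇒∣p∣≤∣q∣; p─q⊆p; ∪-identityˡ)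
    renaming (_∈?_ to _∈ₛ?_)
  open import Data.List.Base using (List; []; _∷_; _++_; length; lookup; replicate;
    cartesianProduct; map; allFin)
  open import Data.List.Membership.DecPropositional using () renaming (_∈?_ to member?)
  open import Data.List.Membership.Propositional using (_∈_; _∉_)
  open import Data.List.Membership.Propositional.Properties using (∈-++⁺ˡ; ∈-++⁺ʳ; ∈-++⁻; ∈-map⁺;
    ∈-cartesianProduct⁺; ∈-allFin; ∈-lookup)
  open import Data.List.Properties using (++-identityʳ; length-replicate; lookup-replicate)
  open import Data.List.Relation.Unary.AllPairs using (AllPairs; []; _∷_)
  open import Data.List.Relation.Binary.Subset.Propositional using (_⊆_)
  open import Data.List.Relation.Unary.All as All using (All; []; _∷_)
  open import Data.List.Relation.Unary.Any using (Any; here; there; index)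
  open import Data.List.Relation.Unary.Any.Properties using (lookup-index)
  open import Data.Nat.Base hiding (_⊔_; ∣_-_∣)
  import Data.Nat.Properties as ℕ
  open import Data.Nat.Properties hiding (_≟_; suc-injective)
  open import Data.Product using (∃-syntax; _×_; _,_; proj₁; proj₂)
  open import Data.Sum using (inj₁; inj₂; [_,_]′)
  open import Data.Vec.Base as Vec using ([]; _∷_; tabulate)
  open import Data.Vec.Properties using (lookup∘tabulate; []=⇒lookup; lookup⇒[]=)
  open import Function using (_∘_; id; _⇔_; mk⇔; Equivalence)
  open import Function.Definitions using (Injective)
  open import Level using (0ℓ)
  open import Relation.Binary.Core using (Rel)
  open import Relation.Binary.PropositionalEquality
  open import Relation.Nullary using (¬_; Dec; yes; no; does)
  open import Relation.Nullary.Decidable using (map′; _×-dec_; _→-dec_; ¬?; decidable-stable; dec-true)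
  open import Relation.Unary using () renaming (Decidable to Decidable₁)

  -- Finite subsets

  ∣p∣≤1+∣p-x∣ : ∀ {n} (p : Subset n) x → ∣ p ∣ ≤ suc ∣ p - x ∣
  ∣p∣≤1+∣p-x∣ p x = begin
    ∣ p ∣                             ≡⟨ ∣∩∣+∣─∣ p ⁅ x ⁆ ⟨
    ∣ p Subset.∩ ⁅ x ⁆ ∣ + ∣ p - x ∣  ≤⟨ +-monoˡ-≤ ∣ p - x ∣ (Subset.∣p∩q∣≤∣q∣ p ⁅ x ⁆) ⟩
    ∣ ⁅ x ⁆ ∣ + ∣ p - x ∣             ≡⟨ cong (_+ ∣ p - x ∣) (Subset.∣⁅x⁆∣≡1 x) ⟩
    suc ∣ p - x ∣                     ∎
    where open ≤-Reasoning

  image : ∀ {m n} → (Fin m → Fin n) → Subset n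
  image {zero}  f = Subset.⊥
  image {suc m} f = ⁅ f zero ⁆ ∪ image (f ∘ suc)

  ∈-image⁺ : ∀ {m n} (f : Fin m → Fin n) i → f i ∈ₛ image f
  ∈-image⁺ f zero    = x∈p∪q⁺ (inj₁ (x∈⁅x⁆ (f zero)))
  ∈-image⁺ f (suc i) = x∈p∪q⁺ (inj₂ (∈-image⁺ (f ∘ suc) i))

  ∈-image⁻ : ∀ {m n} (f : Fin m → Fin n) {x} → x ∈ₛ image f → ∃[ i ] f i ≡ x
  ∈-image⁻ {zero}  f x∈ = ⊥-elim (∉⊥ x∈)
  ∈-image⁻ {suc m} f x∈ with x∈p∪q⁻ ⁅ f zero ⁆ (image (f ∘ suc)) x∈
  ... | inj₁ x∈⁅⁆ = zero , sym (x∈⁅y⁆⇒x≡y (f zero) x∈⁅⁆)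
  ... | inj₂ x∈im = let i , eq = ∈-image⁻ (f ∘ suc) x∈im in suc i , eq

  ∣⁅x⁆∪p∣ : ∀ {n} (x : Fin n) p → x ∉ₛ p → ∣ ⁅ x ⁆ ∪ p ∣ ≡ suc ∣ p ∣
  ∣⁅x⁆∪p∣ zero    (true ∷ p)  x∉p = ⊥-elim (x∉p Vec.here)
  ∣⁅x⁆∪p∣ zero    (false ∷ p) x∉p = cong (suc ∘ ∣_∣) (∪-identityˡ p)
  ∣⁅x⁆∪p∣ (suc x) (true ∷ p)  x∉p = cong suc (∣⁅x⁆∪p∣ x p (x∉p ∘ Vec.there))
  ∣⁅x⁆∪p∣ (suc x) (false ∷ p) x∉p = ∣⁅x⁆∪p∣ x p (x∉p ∘ Vec.there)

  ∣image∣ : ∀ {m n} (f : Fin m → Fin n) → Injective _≡_ _≡_ f → ∣ image f ∣ ≡ m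
  ∣image∣ {zero} {n} f inj = ∣⊥∣≡0 n
  ∣image∣ {suc m} f inj = trans
    (∣⁅x⁆∪p∣ (f zero) (image (f ∘ suc)) λ f0∈ →
      let i , eq = ∈-image⁻ (f ∘ suc) f0∈ in case (inj eq))
    (cong suc (∣image∣ (f ∘ suc) (suc-injective ∘ inj)))
    where
    case : ∀ {i} → suc i ≡ Fin.zero → ⊥
    case ()

  separate : ∀ {n} {P : Fin n → Set} → Decidable₁ P → Subset n
  separate P? = tabulate (does ∘ P?)

  ∈-separate⁺ : ∀ {n} {P : Fin n → Set} (P? : Decidable₁ P) {x} → P x → x ∈ₛ separate P?
  ∈-separate⁺ P? {x} Px = lookup⇒[]= x _ (trans (lookup∘tabulate (does ∘ P?) x) (dec-true (P? x) Px))

  ∈-separate⁻ : ∀ {n} {P : Fin n → Set} (P? : Decidable₁ P) {x} → x ∈ₛ separate P? → P x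
  ∈-separate⁻ P? {x} x∈ with P? x | trans (sym (lookup∘tabulate (does ∘ P?) x)) ([]=⇒lookup x∈)
  ... | yes Px | _ = Px

  subsets : ∀ n → List (Subset n)
  subsets zero    = [] ∷ []
  subsets (suc n) = map (true ∷_) (subsets n) ++ map (false ∷_) (subsets n)

  ∈-subsets : ∀ {n} (p : Subset n) → p ∈ subsets n
  ∈-subsets []          = here refl
  ∈-subsets (true ∷ p)  = ∈-++⁺ˡ (∈-map⁺ (true ∷_) (∈-subsets p))
  ∈-subsets (false ∷ p) = ∈-++⁺ʳ (map (true ∷_) (subsets _)) (∈-map⁺ (false ∷_) (∈-subsets p))

  missed : ∀ {m n} (f : Fin m → Fin n) → m < n → ∃[ j ] (∀ i → f i ≢ j)
  missed {m} {n} f m<n with any? (λ j → all? (λ i → ¬? (f i ≟ j)))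
  ... | yes found = found
  ... | no  none  = ⊥-elim (<⇒≱ m<n (injective⇒≤ {f = preimage} λ {x} {y} eq →
          trans (sym (proj₂ (hit x))) (trans (cong f eq) (proj₂ (hit y)))))
    where
    hit : ∀ j → ∃[ i ] f i ≡ j
    hit j with any? (λ i → f i ≟ j)
    ... | yes found = found
    ... | no  ¬hit  = ⊥-elim (none (j , λ i eq → ¬hit (i , eq)))
    preimage : Fin n → Fin m
    preimage j = proj₁ (hit j)

  -- A clique has at most one vertex in an independent block; deleting it leaves a clique in the
  -- other blocks. The map `f` lets a cover in the final graph bound cliques of an earlier one.
  cover-bound : ∀ (G : Graph) {n} {_~_ : Rel (Fin n) 0ℓ} (f : Vertex G → Fin n) →
    (∀ {u v} → Adj G u v → f u ~ f v) → ∀ {N q} → Cover _~_ N q →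
    ∀ K → IsClique G K → (∀ {s} → s ∈ₛ K → f s ∈ N) → ∣ K ∣ ≤ q
  cover-bound G f f-adj [] K K-clique K⊆ =
    ≤-reflexive (Empty⇒∣p∣≡0 K λ (s , s∈K) → case (K⊆ s∈K))
    where
    case : ∀ {x} → x ∈ [] → ⊥
    case ()
  cover-bound G f f-adj (block L {N} indep c) K K-clique K⊆
    with any? (λ s → (s ∈ₛ? K) ×-dec member? _≟_ (f s) L)
  ... | no  none = m≤n⇒m≤1+n (cover-bound G f f-adj c K K-clique λ {s} s∈K →
          [ (λ fs∈L → ⊥-elim (none (s , s∈K , fs∈L))) , id ]′ (∈-++⁻ L (K⊆ s∈K)))
  ... | yes (s , s∈K , fs∈L) = ≤-trans (∣p∣≤1+∣p-x∣ K s) (s≤s (cover-bound G f f-adj c (K - s)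
          (λ u∈ v∈ → K-clique (p─q⊆p K ⁅ s ⁆ u∈) (p─q⊆p K ⁅ s ⁆ v∈))
          λ {u} u∈ → [ (λ fu∈L → ⊥-elim (indep fs∈L fu∈L (f-adj (K-clique s∈K (p─q⊆p K ⁅ s ⁆ u∈) (s≢ u∈)))))
                     , id ]′ (∈-++⁻ L (K⊆ (p─q⊆p K ⁅ s ⁆ u∈)))))
    where
    s≢ : ∀ {u} → u ∈ₛ K - s → s ≢ u
    s≢ u∈ refl = x∉p-x K s u∈
      where
      x∉p-x : ∀ {n} (p : Subset n) x → ¬ x ∈ₛ p - x
      x∉p-x (_ ∷ p) (suc x) (Vec.there x∈) = x∉p-x p x x∈
      x∉p-x (true ∷ p) zero ()
      x∉p-x (false ∷ p) zero ()

  -- Trees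

  injection-into : ∀ {m n} (f : Fin m → Fin n) → Injective _≡_ _≡_ f → ∀ S → (∀ i → f i ∈ₛ S) →
    m ≤ ∣ S ∣
  injection-into f inj S f∈S = subst (_≤ ∣ S ∣) (∣image∣ f inj)
    (p⊆q⇒∣p∣≤∣q∣ {p = image f} λ v∈ → let i , eq = ∈-image⁻ f v∈ in subst (_∈ₛ S) eq (f∈S i))

  unsuc : ∀ {n} (v : Fin (suc n)) → v ≢ zero → ∃[ w ] v ≡ suc w
  unsuc zero    v≢0 = ⊥-elim (v≢0 refl)
  unsuc (suc w) _   = w , refl

  -- Consider the last vertex added to the tree. If it lies on one side of the biclique, the other
  -- side lies in its neighbourhood, which has s vertices; otherwise the biclique lives in the
  -- smaller tree. The initial clique has only s vertices.
  biclique-bound : ∀ {s t H} → IsTree s H → (x y : Fin t → Vertex H) →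
    Injective _≡_ _≡_ x → Injective _≡_ _≡_ y → (∀ i j → Adj H (x i) (y j)) → t ≤ s
  biclique-bound clique x y x-inj y-inj xy = injective⇒≤ x-inj
  biclique-bound {s} {t} (extend {G} tree S _ ∣S∣≡s) x y x-inj y-inj xy
    with any? (λ i → x i ≟ zero) | any? (λ j → y j ≟ zero)
  ... | yes (i , xi≡0) | _ = subst (t ≤_) ∣S∣≡s (neighbours y y-inj λ j → subst (λ v → Adj′ v (y j)) xi≡0 (xy i j))
    where
    Adj′ = Adj (addVertex G S)
    neighbours : (z : Fin t → Vertex (addVertex G S)) → Injective _≡_ _≡_ z → (∀ j → Adj′ zero (z j)) →
      t ≤ ∣ S ∣
    neighbours z z-inj adj = injection-into z z-inj (outside ∷ S) λ j → inS (z j) (adj j)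
      where
      inS : ∀ v → Adj′ zero v → v ∈ₛ outside ∷ S
      inS (suc v) v∈S = Vec.there v∈S
  ... | no x≢0 | yes (j , yj≡0) = subst (t ≤_) ∣S∣≡s (injection-into x x-inj (outside ∷ S) λ i →
    inS (x i) (subst (λ v → Adj (addVertex G S) (x i) v) yj≡0 (xy i j)))
    where
    inS : ∀ v → Adj (addVertex G S) v zero → v ∈ₛ outside ∷ S
    inS (suc v) v∈S = Vec.there v∈S
  ... | no x≢0 | no y≢0 = biclique-bound tree (proj₁ ∘ x′) (proj₁ ∘ y′) (inj x′ x-inj) (inj y′ y-inj)
    λ i j → subst₂ (Adj (addVertex G S)) (proj₂ (x′ i)) (proj₂ (y′ j)) (xy i j)
    where
    x′ : ∀ i → ∃[ v ] x i ≡ suc v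
    x′ i = unsuc (x i) λ eq → x≢0 (i , eq)
    y′ : ∀ j → ∃[ v ] y j ≡ suc v
    y′ j = unsuc (y j) λ eq → y≢0 (j , eq)
    inj : ∀ {z : Fin t → Vertex (addVertex G S)} (z′ : ∀ i → ∃[ v ] z i ≡ suc v) →
      Injective _≡_ _≡_ z → Injective _≡_ _≡_ (proj₁ ∘ z′)
    inj z′ z-inj {i} {j} eq = z-inj (trans (proj₂ (z′ i)) (trans (cong suc eq) (sym (proj₂ (z′ j)))))

  -- The universal graphs

  module Universal (t ω : ℕ) where

    -- A is the adjacency of the graph, H the t-tree containing it.
    record State : Set₁ where
      field
        H     : Graph
        tree  : IsTree t H
        A     : Rel (Vertex H) 0ℓ
        A?    : ∀ u v → Dec (A u v)
        A-sym : ∀ {u v} → A u v → A v u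
        A-irr : ∀ {v} → A v v → ⊥
        A⊆H   : ∀ {u v} → A u v → Adj H u v

      graph : Graph
      graph = record { order = order H ; Adj = A ; adj? = A? ; symm = A-sym ; irrefl = A-irr }

      field
        small : ∀ K → IsClique graph K → ∣ K ∣ ≤ ω

    open State

    -- A move: the tree gains a vertex on the `t`-clique `S`, while the graph joins it only to `N`.
    -- Any clique through the new vertex has its other vertices in `N`, so `legal` preserves the
    -- bound `ω`.
    record Request (T : State) : Set where
      field
        {S}    : Subset (order (H T))
        {N}    : Subset (order (H T))
        S-clique : IsClique (H T) S
        ∣S∣≡t  : ∣ S ∣ ≡ t
        N⊆S    : N ⊆ₛ S
        legal  : ∀ K → K ⊆ₛ N → IsClique (graph T) K → ∣ K ∣ < ω

    open Request

    grow : (T : State) → Request T → State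
    grow T r = record
      { H     = addVertex (H T) (S r)
      ; tree  = extend (tree T) (S r) (S-clique r) (∣S∣≡t r)
      ; A     = Adj G′
      ; A?    = adj? G′
      ; A-sym = λ {u} {v} → symm G′ {u} {v}
      ; A-irr = λ {v} → irrefl G′ {v}
      ; A⊆H   = λ {u} {v} → sub u v
      ; small = small′
      }
      where
      G′ = addVertex (graph T) (N r)
      sub : ∀ u v → Adj G′ u v → Adj (addVertex (H T) (S r)) u v
      sub zero    (suc v) = N⊆S r
      sub (suc u) zero    = N⊆S r
      sub (suc u) (suc v) = A⊆H T
      tail-clique : ∀ {s K} → IsClique G′ (s ∷ K) → IsClique (graph T) K
      tail-clique K-clique u∈ v∈ u≢v = K-clique (Vec.there u∈) (Vec.there v∈) (u≢v ∘ suc-injective)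
      small′ : ∀ K → IsClique G′ K → ∣ K ∣ ≤ ω
      small′ (true ∷ K)  K-clique = legal r K (λ u∈ → K-clique Vec.here (Vec.there u∈) λ ()) (tail-clique K-clique)
      small′ (false ∷ K) K-clique = small T K (tail-clique K-clique)

    -- A request stays legal after another one is served, since its `S` and `N` avoid the new
    -- vertex. Hence all requests of one state can be served in the same round.
    lift : ∀ {T} (r : Request T) → Request T → Request (grow T r)
    lift {T} r r′ = record
      { S        = outside ∷ S r′
      ; N        = outside ∷ N r′
      ; S-clique = λ { {suc u} {suc v} (Vec.there u∈) (Vec.there v∈) u≢v → S-clique r′ u∈ v∈ (u≢v ∘ cong suc) }
      ; ∣S∣≡t    = ∣S∣≡t r′
      ; N⊆S      = λ { (Vec.there u∈) → Vec.there (N⊆S r′ u∈) }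
      ; legal    = legal′
      }
      where
      legal′ : ∀ K → K ⊆ₛ outside ∷ N r′ → IsClique (graph (grow T r)) K → ∣ K ∣ < ω
      legal′ (true ∷ K)  K⊆ K-clique with () ← K⊆ Vec.here
      legal′ (false ∷ K) K⊆ K-clique = legal r′ K (λ u∈ → drop-there (K⊆ (Vec.there u∈)))
        λ u∈ v∈ u≢v → K-clique (Vec.there u∈) (Vec.there v∈) (u≢v ∘ suc-injective)

    grow-all : (T : State) → List (Request T) → State
    lift-all : ∀ {T} (L : List (Request T)) → Request T → Request (grow-all T L)
    grow-all T []      = T
    grow-all T (r ∷ L) = grow (grow-all T L) (lift-all L r)
    lift-all []      r′ = r′
    lift-all (r ∷ L) r′ = lift (lift-all L r) (lift-all L r′)

    old : ∀ {T} (L : List (Request T)) → Vertex (H T) → Vertex (H (grow-all T L))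
    old []      v = v
    old (r ∷ L) v = suc (old L v)

    new : ∀ {T} (L : List (Request T)) → Fin (length L) → Vertex (H (grow-all T L))
    new (r ∷ L) zero    = zero
    new (r ∷ L) (suc i) = suc (new L i)

    old-injective : ∀ {T} (L : List (Request T)) → Injective _≡_ _≡_ (old L)
    old-injective []      eq = eq
    old-injective (r ∷ L) eq = old-injective L (suc-injective eq)

    new-injective : ∀ {T} (L : List (Request T)) → Injective _≡_ _≡_ (new L)
    new-injective (r ∷ L) {zero}  {zero}  eq = refl
    new-injective (r ∷ L) {suc i} {suc j} eq = cong suc (new-injective L (suc-injective eq))

    new≢old : ∀ {T} (L : List (Request T)) i v → new L i ≢ old L v
    new≢old (r ∷ L) (suc i) v eq = new≢old L i v (suc-injective eq)

    old-A : ∀ {T} (L : List (Request T)) {u v} → A (grow-all T L) (old L u) (old L v) ⇔ A T u v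
    old-A []      = mk⇔ id id
    old-A (r ∷ L) = old-A L

    old-H : ∀ {T} (L : List (Request T)) {u v} → Adj (H T) u v → Adj (H (grow-all T L)) (old L u) (old L v)
    old-H []      uv = uv
    old-H (r ∷ L) uv = old-H L uv

    old-S : ∀ {T} (L : List (Request T)) {r v} → v ∈ₛ S r → old L v ∈ₛ S (lift-all L r)
    old-S []      v∈ = v∈
    old-S (_ ∷ L) v∈ = Vec.there (old-S L v∈)

    old-N : ∀ {T} (L : List (Request T)) {r v} → old L v ∈ₛ N (lift-all L r) ⇔ v ∈ₛ N r
    old-N []          = mk⇔ id id
    old-N (r ∷ L) {r′} = mk⇔ (λ v∈ → Equivalence.to (old-N L {r′}) (drop-there v∈))
                             (λ v∈ → Vec.there (Equivalence.from (old-N L {r′}) v∈))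

    new-A : ∀ {T} (L : List (Request T)) i {v} → A (grow-all T L) (new L i) (old L v) ⇔ v ∈ₛ N (lookup L i)
    new-A (r ∷ L) zero    = old-N L {r}
    new-A (r ∷ L) (suc i) = new-A L i

    new-H : ∀ {T} (L : List (Request T)) i {v} → v ∈ₛ S (lookup L i) → Adj (H (grow-all T L)) (new L i) (old L v)
    new-H (r ∷ L) zero    v∈ = old-S L {r} v∈
    new-H (r ∷ L) (suc i) v∈ = new-H L i v∈

    clique? : ∀ G K → Dec (IsClique G K)
    clique? G K = map′ (λ h {u} {v} → h u v) (λ h u v → h {u} {v})
      (all? λ u → all? λ v → (u ∈ₛ? K) →-dec ((v ∈ₛ? K) →-dec (¬? (u ≟ v) →-dec adj? G u v)))

    -- The clique condition is a negated existential because this is the form decided by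
    -- `anySubset?`; `request` returns to the universal form by stability.
    Valid : (T : State) → Subset (order (H T)) → Subset (order (H T)) → Set
    Valid T S N = IsClique (H T) S × ∣ S ∣ ≡ t × N ⊆ₛ S ×
      (¬ (∃[ K ] K ⊆ₛ N × IsClique (graph T) K × ¬ ∣ K ∣ < ω))

    valid? : ∀ T S N → Dec (Valid T S N)
    valid? T S N = clique? (H T) S ×-dec (∣ S ∣ ℕ.≟ t) ×-dec (N ⊆? S) ×-dec
      ¬? (anySubset? λ K → (K ⊆? N) ×-dec clique? (graph T) K ×-dec ¬? (∣ K ∣ <? ω))

    request : ∀ {T S N} → Valid T S N → Request T
    request (S-clique , ∣S∣≡t , N⊆S , none) = record
      { S-clique = S-clique ; ∣S∣≡t = ∣S∣≡t ; N⊆S = N⊆S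
      ; legal = λ K K⊆N K-clique → decidable-stable (∣ K ∣ <? ω) λ ≮ω → none (K , K⊆N , K-clique , ≮ω) }

    collect : ∀ T → List (Subset (order (H T)) × Subset (order (H T))) → List (Request T)
    collect T []             = []
    collect T ((S , N) ∷ ps) with valid? T S N
    ... | yes valid = request valid ∷ collect T ps
    ... | no  _     = collect T ps

    -- Requests contain proofs, so a given one is found only up to its two vertex sets; these
    -- determine the adjacencies of the new vertex.
    collect-complete : ∀ T (r : Request T) {ps} → (S r , N r) ∈ ps →
      Any (λ r′ → S r′ ≡ S r × N r′ ≡ N r) (collect T ps)
    collect-complete T r (here refl) with valid? T (S r) (N r)
    ... | yes valid = here (refl , refl)
    ... | no  ¬valid = ⊥-elim (¬valid (S-clique r , ∣S∣≡t r , N⊆S r ,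
                         λ (K , K⊆N , K-clique , ≮ω) → ≮ω (legal r K K⊆N K-clique)))
    collect-complete T r (there {S′ , N′} r∈) with valid? T S′ N′
    ... | yes valid  = there (collect-complete T r r∈)
    ... | no  _      = collect-complete T r r∈

    requests : ∀ T → List (Request T)
    requests T = collect T (cartesianProduct (subsets _) (subsets _))

    round : State → State
    round T = grow-all T (requests T)

    requested : ∀ T (r : Request T) → ∃[ i ] S (lookup (requests T) i) ≡ S r × N (lookup (requests T) i) ≡ N r
    requested T r = index any , lookup-index any
      where
      any : Any (λ r′ → S r′ ≡ S r × N r′ ≡ N r) (requests T)
      any = collect-complete T r (∈-cartesianProduct⁺ (∈-subsets (S r)) (∈-subsets (N r)))

    -- The round is applied before the recursion, so `rounds (suc r) T` is `rounds r (round T)` by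
    -- definition; a move can then advance the state of a bag and keep its map into the final graph.
    rounds : ℕ → State → State
    rounds zero    T = T
    rounds (suc r) T = rounds r (round T)

    embed : ∀ r T → Vertex (H T) → Vertex (H (rounds r T))
    embed zero    T v = v
    embed (suc r) T v = embed r (round T) (old (requests T) v)

    embed-injective : ∀ r T → Injective _≡_ _≡_ (embed r T)
    embed-injective zero    T eq = eq
    embed-injective (suc r) T eq = old-injective (requests T) (embed-injective r (round T) eq)

    embed-A : ∀ r T {u v} → A (rounds r T) (embed r T u) (embed r T v) ⇔ A T u v
    embed-A zero    T = mk⇔ id id
    embed-A (suc r) T = mk⇔ (to (old-A (requests T)) ∘ to (embed-A r (round T)))
                            (from (embed-A r (round T)) ∘ from (old-A (requests T)))
      where open Equivalence

    -- Positions of the game inside the final graph.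

    module Bags (F : State) where

      open Equivalence

      _~_ : Rel (Vertex (H F)) 0ℓ
      _~_ = A F

      -- P lies in a (t + 1)-clique of a tree H from which r rounds lead to F.
      record Bag (r : ℕ) (P : List (Vertex (H F))) : Set₁ where
        field
          T        : State
          g        : Vertex (H (rounds r T)) → Vertex (H F)
          g-inj    : Injective _≡_ _≡_ g
          g-A      : ∀ {u v} → A (rounds r T) u v ⇔ g u ~ g v
          β        : Fin (suc t) → Vertex (H T)
          β-clique : ∀ {x y} → x ≢ y → Adj (H T) (β x) (β y)
          contains : ∀ {w} → w ∈ P → ∃[ x ] g (embed r T (β x)) ≡ w

      shrink : ∀ {r P Q} → Bag r P → Q ⊆ P → Bag r Q
      shrink bag Q⊆P = record
        { T = T ; g = g ; g-inj = g-inj ; g-A = g-A ; β = β ; β-clique = β-clique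
        ; contains = λ w∈ → contains (Q⊆P w∈) }
        where open Bag bag

      module Add {r q N M} (bag : Bag (suc r) (N ++ M)) (fits : length (N ++ M) ≤ t)
        (c : Cover _~_ N q) (q<ω : q < ω) (M∉N : All (_∉ N) M) where

        open Bag bag

        β-injective : Injective _≡_ _≡_ β
        β-injective {x} {y} eq with x ≟ y
        ... | yes x≡y = x≡y
        ... | no  x≢y = ⊥-elim (irrefl (H T) (subst (Adj (H T) (β x)) (sym eq) (β-clique x≢y)))

        f : Vertex (H T) → Vertex (H F)
        f v = g (embed (suc r) T v)

        f-A : ∀ {u v} → f u ~ f v ⇔ A T u v
        f-A = mk⇔ (to (embed-A (suc r) T) ∘ from g-A) (to g-A ∘ from (embed-A (suc r) T))

        slot : Fin (length (N ++ M)) → Fin (suc t)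
        slot i = proj₁ (contains (∈-lookup i))

        f-slot : ∀ {w} (w∈ : w ∈ N ++ M) → f (β (slot (index w∈))) ≡ w
        f-slot w∈ = trans (proj₂ (contains (∈-lookup (index w∈)))) (sym (lookup-index w∈))

        -- The listed vertices occupy at most t of the t + 1 places. The vertex in the free place is
        -- given up, and the other t places form the clique on which the new vertex is put.
        free : ∃[ j ] (∀ i → slot i ≢ j)
        free = missed slot (s≤s fits)

        j : Fin (suc t)
        j = proj₁ free

        γ : Fin t → Vertex (H T)
        γ = β ∘ punchIn j

        γ-injective : Injective _≡_ _≡_ γ
        γ-injective = punchIn-injective j _ _ ∘ β-injective

        β∈γ : ∀ {x} → x ≢ j → β x ∈ₛ image γ
        β∈γ {x} x≢j = subst (λ y → β y ∈ₛ image γ) (punchIn-punchOut (x≢j ∘ sym))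
          (∈-image⁺ γ (punchOut (x≢j ∘ sym)))

        -- `N` consists of vertices of the final graph and the request lives in `T`, so membership
        -- is tested through `f`. Bag vertices that are not listed are thereby left nonadjacent to
        -- the new vertex.
        In : Vertex (H T) → Set
        In v = v ∈ₛ image γ × f v ∈ N

        In? : Decidable₁ In
        In? v = (v ∈ₛ? image γ) ×-dec member? _≟_ (f v) N

        r₀ : Request T
        r₀ = record
          { S        = image γ
          ; N        = separate In?
          ; S-clique = λ {u} {v} u∈ v∈ u≢v →
              let x , γx≡u = ∈-image⁻ γ u∈
                  y , γy≡v = ∈-image⁻ γ v∈
              in subst₂ (Adj (H T)) γx≡u γy≡v (β-clique λ eq →
                   u≢v (trans (sym γx≡u) (trans (cong β eq) γy≡v)))
          ; ∣S∣≡t    = ∣image∣ γ γ-injective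
          ; N⊆S      = λ v∈ → proj₁ (∈-separate⁻ In? v∈)
          ; legal    = λ K K⊆ K-clique → ≤-trans (s≤s
              (cover-bound (graph T) f (from f-A) c K K-clique λ s∈K → proj₂ (∈-separate⁻ In? (K⊆ s∈K)))) q<ω
          }

        L : List (Request T)
        L = requests T

        i : Fin (length L)
        i = proj₁ (requested T r₀)

        T′ : State
        T′ = round T

        v′ : Vertex (H T′)
        v′ = new L i

        v : Vertex (H F)
        v = g (embed r T′ v′)

        v′-A : ∀ {s} → A T′ v′ (old L s) ⇔ In s
        v′-A {s} = mk⇔
          (λ a → ∈-separate⁻ In? (subst (s ∈ₛ_) (proj₂ (proj₂ (requested T r₀))) (to (new-A L i) a)))
          (λ s∈ → from (new-A L i) (subst (s ∈ₛ_) (sym (proj₂ (proj₂ (requested T r₀)))) (∈-separate⁺ In? s∈)))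

        v-A : ∀ {s} → v ~ f s ⇔ In s
        v-A = mk⇔ (to v′-A ∘ to (embed-A r T′) ∘ from g-A) (to g-A ∘ from (embed-A r T′) ∘ from v′-A)

        v′-H : ∀ {x} → x ≢ j → Adj (H T′) v′ (old L (β x))
        v′-H x≢j = new-H L i (subst (_ ∈ₛ_) (sym (proj₁ (proj₂ (requested T r₀)))) (β∈γ x≢j))

        v≢f : ∀ s → v ≢ f s
        v≢f s eq = new≢old L i s (embed-injective r T′ (g-inj eq))

        β′ : Fin (suc t) → Vertex (H T′)
        β′ x with x ≟ j
        ... | yes _ = v′
        ... | no  _ = old L (β x)

        β′-clique : ∀ {x y} → x ≢ y → Adj (H T′) (β′ x) (β′ y)
        β′-clique {x} {y} x≢y with x ≟ j | y ≟ j
        ... | yes x≡j | yes y≡j = ⊥-elim (x≢y (trans x≡j (sym y≡j)))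
        ... | yes x≡j | no  y≢j = v′-H y≢j
        ... | no  x≢j | yes y≡j = symm (H T′) (v′-H x≢j)
        ... | no  x≢j | no  y≢j = old-H L (β-clique x≢y)

        β′-j : β′ j ≡ v′
        β′-j with j ≟ j
        ... | yes _   = refl
        ... | no  j≢j = ⊥-elim (j≢j refl)

        β′-slot : ∀ k → β′ (slot k) ≡ old L (β (slot k))
        β′-slot k with slot k ≟ j
        ... | yes eq = ⊥-elim (proj₂ free k eq)
        ... | no  _  = refl

        bag′ : Bag r (v ∷ N ++ M)
        bag′ = record
          { T = T′ ; g = g ; g-inj = g-inj ; g-A = g-A ; β = β′ ; β-clique = β′-clique
          ; contains = λ
              { (here refl) → j , cong (g ∘ embed r T′) β′-j
              ; (there w∈)  → slot (index w∈) ,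
                  trans (cong (g ∘ embed r T′) (β′-slot (index w∈))) (f-slot w∈) } }

        in-γ : ∀ {w} (w∈ : w ∈ N ++ M) → β (slot (index w∈)) ∈ₛ image γ
        in-γ w∈ = β∈γ (proj₂ free (index w∈))

        adjacent : ∀ {w} → w ∈ N → v ~ w
        adjacent w∈ = subst (v ~_) (f-slot w∈′) (from v-A (in-γ w∈′ , subst (_∈ N) (sym (f-slot w∈′)) w∈))
          where w∈′ = ∈-++⁺ˡ w∈

        nonadjacent : ∀ {w} → w ∈ M → ¬ v ~ w
        nonadjacent w∈ v~w = All.lookup M∉N w∈
          (subst (_∈ N) (f-slot w∈′) (proj₂ (to v-A (subst (v ~_) (sym (f-slot w∈′)) v~w))))
          where w∈′ = ∈-++⁺ʳ N w∈

        fresh : ∀ {w} → w ∈ N ++ M → v ≢ w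
        fresh w∈ eq = v≢f _ (trans eq (sym (f-slot w∈)))

      add : ∀ {r q} N M → Bag (suc r) (N ++ M) → length (N ++ M) ≤ t → Cover _~_ N q → q < ω →
        All (_∉ N) M →
        ∃[ v ] Bag r (v ∷ N ++ M) × All (v ~_) N × All (λ w → ¬ v ~ w) M × All (v ≢_) (N ++ M)
      add N M bag fits c q<ω M∉N = v , bag′ , All.tabulate adjacent , All.tabulate nonadjacent , All.tabulate fresh
        where open Add bag fits c q<ω M∉N

  lookup-AllPairs : ∀ {V : Set} {_~_ : Rel V 0ℓ} → (∀ {u v} → u ~ v → v ~ u) →
    ∀ {vs} → AllPairs _~_ vs → ∀ {i j} → i ≢ j → lookup vs i ~ lookup vs j
  lookup-AllPairs ~-sym (v~ ∷ ps) {zero}  {zero}  i≢j = ⊥-elim (i≢j refl)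
  lookup-AllPairs ~-sym (v~ ∷ ps) {zero}  {suc j} i≢j = All.lookup v~ (∈-lookup j)
  lookup-AllPairs ~-sym (v~ ∷ ps) {suc i} {zero}  i≢j = ~-sym (All.lookup v~ (∈-lookup i))
  lookup-AllPairs ~-sym (v~ ∷ ps) {suc i} {suc j} i≢j = lookup-AllPairs ~-sym ps (i≢j ∘ cong suc)

  pairwise-clique : ∀ (G : Graph) {vs} → AllPairs (Adj G) vs →
    ∃[ S ] IsClique G S × ∣ S ∣ ≡ length vs
  pairwise-clique G {vs} ps = image (lookup vs) ,
    (λ u∈ v∈ u≢v →
      let i , eq₁ = ∈-image⁻ (lookup vs) u∈
          j , eq₂ = ∈-image⁻ (lookup vs) v∈
      in subst₂ (Adj G) eq₁ eq₂ (lookup-AllPairs (symm G) ps λ i≡j →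
           u≢v (trans (sym eq₁) (trans (cong (lookup vs) i≡j) eq₂)))) ,
    ∣image∣ (lookup vs) injective
    where
    injective : Injective _≡_ _≡_ (lookup vs)
    injective {i} {j} eq with i ≟ j
    ... | yes i≡j = i≡j
    ... | no  i≢j = ⊥-elim (irrefl G (subst (λ v → Adj G v (lookup vs j)) eq (lookup-AllPairs (symm G) ps i≢j)))

  -- Treewidth, clique number and colourings of the final graph.

  module Bounds (m₀ d : ℕ) where

    -- The first `ω` rounds exhibit a clique of `ω` vertices; the remaining ones suffice for a play
    -- against any colouring.
    t ω D : ℕ
    t = suc m₀ + (d + d)
    ω = suc m₀ + d
    D = ω + cost m₀ (suc d)

    open Universal t ω
    open State

    treewidth : ∀ F (x y : Fin t → Vertex (H F)) → Injective _≡_ _≡_ x → Injective _≡_ _≡_ y →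
      (∀ i j → A F (x i) (y j)) → HasTreewidth (graph F) t
    treewidth F x y x-inj y-inj xy =
      (H F , tree F , id , id , A⊆H F) , λ s (H′ , tree′ , f , f-inj , f-adj) →
      biclique-bound tree′ (f ∘ x) (f ∘ y) (x-inj ∘ f-inj) (y-inj ∘ f-inj) λ i j → f-adj (xy i j)

    module _ (F : State) (start : Bags.Bag F D []) where

      open Bags F

      open Tower _~_ (A-sym F) (A-irr F)
      open Strategy t ω Bag shrink (λ {r} {q} → add {r} {q})

      largest-clique : Added (cost m₀ (suc d)) [] [] ω
      largest-clique = add-many ω [] [] start
        (≤-trans (+-monoʳ-≤ (suc m₀) (m≤m+n d d)) (n≤1+n t)) [] (≤-reflexive (+-identityʳ ω)) []

      open Added largest-clique

      ω-clique : ∃[ S ] IsClique (graph F) S × ∣ S ∣ ≡ ω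
      ω-clique = let S , S-clique , ∣S∣≡ = pairwise-clique (graph F) pairwise in
        S , S-clique , trans ∣S∣≡ length≡

      start′ : Bag (cost m₀ (suc d)) []
      start′ = shrink bag λ ()

      colouring-bound : ∀ b k → Colouring (graph F) b k →
        ∃[ s ] Losses (suc m₀) b (suc d) s × b * suc t ≤ k + s
      colouring-bound b k (φ , ∣φ∣≡b , disjoint) =
        Play.stages φ ∣φ∣≡b disjoint m₀ d refl refl (suc d) [] refl (+-identityʳ (suc d))
          start′

  module Construction (m₀ d : ℕ) (2≤ω : 2 ≤ suc m₀ + d) where

    open Bounds m₀ d
    open Universal t ω
    open State
    open Equivalence

    empty : Graph
    empty = record
      { order = t ; Adj = λ _ _ → ⊥ ; adj? = λ _ _ → no id ; symm = id ; irrefl = id }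

    empty-clique : ∀ K → IsClique empty K → ∣ K ∣ ≤ 1
    empty-clique K K-clique = cover-bound empty {_~_ = λ _ _ → ⊥} id id
      (block (allFin t) (λ _ _ → id) []) K K-clique
      λ {s} _ → subst (s ∈_) (sym (++-identityʳ (allFin t))) (∈-allFin s)

    edgeless : State
    edgeless = record
      { H = complete t ; tree = clique ; A = λ _ _ → ⊥ ; A? = λ _ _ → no id ; A-sym = id ; A-irr = id
      ; A⊆H = λ () ; small = λ K K-clique → ≤-trans (empty-clique K K-clique) (≤-trans (s≤s z≤n) 2≤ω) }

    -- Cliques of the edgeless graph have at most one vertex, so the cliques of the biclique have at
    -- most two; this is where `2≤ω` enters.
    join : Request edgeless
    join = record
      { S = ⊤ ; N = ⊤ ; S-clique = λ _ _ u≢v → u≢v ; ∣S∣≡t = ∣⊤∣≡n t ; N⊆S = id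
      ; legal = λ K _ K-clique → ≤-trans (s≤s (empty-clique K K-clique)) 2≤ω }

    joins : List (Request edgeless)
    joins = replicate t join

    -- The biclique K_{t,t} forces treewidth t.
    biclique : State
    biclique = grow-all edgeless joins

    left right : Fin t → Vertex (H biclique)
    left i  = new joins (cast (sym (length-replicate t)) i)
    right j = old joins j

    left-injective : Injective _≡_ _≡_ left
    left-injective {i} {j} eq = toℕ-injective (trans (sym (toℕ-cast e i))
      (trans (cong toℕ (new-injective joins eq)) (toℕ-cast e j)))
      where e = sym (length-replicate t {join})

    left-right : ∀ i j → A biclique (left i) (right j)
    left-right i j = from (new-A joins (cast (sym (length-replicate t)) i)) (subst (λ r → j ∈ₛ Request.N r)
      (sym (lookup-replicate t join i)) ∈⊤)

    F : State
    F = rounds D biclique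

    -- The bag consists of the initial `t`-clique of the tree and the first vertex joined to it. Its
    -- list is empty: the play starts without using any of them.
    start : Bags.Bag F D []
    start = record
      { T = biclique ; g = id ; g-inj = id ; g-A = mk⇔ id id
      ; β = λ { zero → new joins zero ; (suc y) → old joins y }
      ; β-clique = λ
          { {zero}  {zero}  x≢y → ⊥-elim (x≢y refl)
          ; {zero}  {suc y} x≢y → new-H joins zero ∈⊤
          ; {suc x} {zero}  x≢y → symm (H biclique) {new joins zero} {old joins x} (new-H joins zero ∈⊤)
          ; {suc x} {suc y} x≢y → old-H joins (x≢y ∘ cong suc) }
      ; contains = λ () }

    left′ right′ : Fin t → Vertex (H F)
    left′  = embed D biclique ∘ left
    right′ = embed D biclique ∘ right

    left′-injective : Injective _≡_ _≡_ left′
    left′-injective eq = left-injective (embed-injective D biclique eq)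

    right′-injective : Injective _≡_ _≡_ right′
    right′-injective eq = old-injective joins (embed-injective D biclique eq)

    left′-right′ : ∀ i j → A F (left′ i) (right′ j)
    left′-right′ i j = from (embed-A D biclique {left i} {right j}) (left-right i j)

    abstract
      construction : ∃[ G ] HasTreewidth G t × IsCliqueNumber G ω ×
        (∀ b k → Colouring G b k → ∃[ s ] Losses (suc m₀) b (suc d) s × b * suc t ≤ k + s)
      construction = graph F , treewidth F left′ right′ left′-injective right′-injective left′-right′ ,
        (ω-clique F start , small F) , colouring-bound F start

-- Comparison of the losses with the logarithm.

module Analysis where

  open Strategies using (Losses; []; step)
  open import Defs using (ℝ; seq; cauchy; fromℚ; fromℕ; expPartialSum; IsLog; IsFloor)
  import Defs as R
  open import Data.Empty using (⊥-elim)
  open import Data.Integer.Base as ℤ using (+_)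
  import Data.Integer.Properties as ℤ
  open import Data.Nat.Base as ℕ using (ℕ; zero; suc; _!)
  import Data.Nat.Properties as ℕ
  open import Data.Product using (∃-syntax; _×_; _,_; proj₁; proj₂)
  open import Data.Rational.Base
  open import Data.Rational.Properties
  open import Data.Rational.Solver using (module +-*-Solver)
  import Data.Rational.Unnormalised.Base as ℚᵘ
  import Data.Rational.Unnormalised.Properties as ℚᵘ
  open import Data.Sum using (inj₁; inj₂)
  open import Relation.Binary.PropositionalEquality
  open +-*-Solver using (solve; _:=_; _:+_; _:*_; _:-_; :-_; con)

  ι : ℕ → ℚ
  ι n = + n / 1

  toℚᵘ-ι : ∀ n → toℚᵘ (ι n) ℚᵘ.≃ ℚᵘ.mkℚᵘ (+ n) 0
  toℚᵘ-ι n = toℚᵘ-fromℚᵘ (ℚᵘ.mkℚᵘ (+ n) 0)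

  /-* : ∀ n d → (+ n / suc d) * ι (suc d) ≡ ι n
  /-* n d = toℚᵘ-injective (begin
    toℚᵘ ((+ n / suc d) * ι (suc d))                ≈⟨ toℚᵘ-homo-* (+ n / suc d) (ι (suc d)) ⟩
    toℚᵘ (+ n / suc d) ℚᵘ.* toℚᵘ (ι (suc d))        ≈⟨ ℚᵘ.*-cong (toℚᵘ-fromℚᵘ (ℚᵘ.mkℚᵘ (+ n) d)) (toℚᵘ-ι (suc d)) ⟩
    ℚᵘ.mkℚᵘ (+ n) d ℚᵘ.* ℚᵘ.mkℚᵘ (+ suc d) 0
      ≈⟨ ℚᵘ.*≡* (trans (ℤ.*-assoc (+ n) (+ suc d) (+ 1)) (cong (+ n ℤ.*_) (trans (ℤ.*-identityʳ (+ suc d)) (cong (+_) (sym (ℕ.*-identityʳ (suc d))))))) ⟩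
    ℚᵘ.mkℚᵘ (+ n) 0                                 ≈⟨ toℚᵘ-ι n ⟨
    toℚᵘ (ι n)                                      ∎)
    where open ℚᵘ.≃-Reasoning

  ι-+ : ∀ m n → ι (m ℕ.+ n) ≡ ι m + ι n
  ι-+ m n = toℚᵘ-injective (begin
    toℚᵘ (ι (m ℕ.+ n))                          ≈⟨ toℚᵘ-ι (m ℕ.+ n) ⟩
    ℚᵘ.mkℚᵘ (+ (m ℕ.+ n)) 0
      ≈⟨ ℚᵘ.*≡* (cong (ℤ._* + 1) (cong₂ ℤ._+_ (sym (ℤ.*-identityʳ (+ m))) (sym (ℤ.*-identityʳ (+ n))))) ⟩
    ℚᵘ.mkℚᵘ (+ m) 0 ℚᵘ.+ ℚᵘ.mkℚᵘ (+ n) 0        ≈⟨ ℚᵘ.+-cong (toℚᵘ-ι m) (toℚᵘ-ι n) ⟨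
    toℚᵘ (ι m) ℚᵘ.+ toℚᵘ (ι n)                  ≈⟨ toℚᵘ-homo-+ (ι m) (ι n) ⟨
    toℚᵘ (ι m + ι n)                            ∎)
    where open ℚᵘ.≃-Reasoning

  ι-* : ∀ m n → ι (m ℕ.* n) ≡ ι m * ι n
  ι-* m n = toℚᵘ-injective (begin
    toℚᵘ (ι (m ℕ.* n))                          ≈⟨ toℚᵘ-ι (m ℕ.* n) ⟩
    ℚᵘ.mkℚᵘ (+ (m ℕ.* n)) 0                     ≈⟨ ℚᵘ.*≡* (cong (ℤ._* + 1) (ℤ.pos-* m n)) ⟩
    ℚᵘ.mkℚᵘ (+ m) 0 ℚᵘ.* ℚᵘ.mkℚᵘ (+ n) 0        ≈⟨ ℚᵘ.*-cong (toℚᵘ-ι m) (toℚᵘ-ι n) ⟨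
    toℚᵘ (ι m) ℚᵘ.* toℚᵘ (ι n)                  ≈⟨ toℚᵘ-homo-* (ι m) (ι n) ⟨
    toℚᵘ (ι m * ι n)                            ∎)
    where open ℚᵘ.≃-Reasoning

  ι-mono-≤ : ∀ {m n} → m ℕ.≤ n → ι m ≤ ι n
  ι-mono-≤ {m} {n} m≤n = toℚᵘ-cancel-≤ (ℚᵘ.≤-respˡ-≃ (ℚᵘ.≃-sym (toℚᵘ-ι m)) (ℚᵘ.≤-respʳ-≃ (ℚᵘ.≃-sym (toℚᵘ-ι n))
    (ℚᵘ.*≤* (ℤ.*-monoʳ-≤-nonNeg (+ 1) (ℤ.+≤+ m≤n)))))

  ι-cancel-< : ∀ {m n} → ι m < ι n → m ℕ.< n
  ι-cancel-< {m} {n} m<n with ℕ.≤-<-connex n m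
  ... | inj₁ n≤m = ⊥-elim (<-irrefl refl (<-≤-trans m<n (ι-mono-≤ n≤m)))
  ... | inj₂ m<n = m<n

  0≤ι : ∀ n → 0ℚ ≤ ι n
  0≤ι n = ι-mono-≤ {0} {n} ℕ.z≤n

  0<ι : ∀ n → 0ℚ < ι (suc n)
  0<ι n = <-≤-trans (positive⁻¹ 1ℚ) (ι-mono-≤ {1} {suc n} (ℕ.s≤s ℕ.z≤n))

  ι-suc : ∀ n → ι (suc n) ≡ 1ℚ + ι n
  ι-suc n = ι-+ 1 n

  -- Polynomial inequalities are proved by exhibiting the difference of the two sides as a
  -- combination of products of nonnegative quantities.
  by-difference : ∀ {p q} r → 0ℚ ≤ r → q ≡ p + r → p ≤ q
  by-difference {p} {q} r 0≤r q≡p+r =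
    subst₂ _≤_ (+-identityʳ p) (sym q≡p+r) (+-monoʳ-≤ p 0≤r)

  0≤difference : ∀ {p q} → p ≤ q → 0ℚ ≤ q - p
  0≤difference {p} {q} p≤q = subst (_≤ q - p) (+-inverseʳ p) (+-monoˡ-≤ (- p) p≤q)

  0≤+ : ∀ {p q} → 0ℚ ≤ p → 0ℚ ≤ q → 0ℚ ≤ p + q
  0≤+ = +-mono-≤

  0≤* : ∀ {p q} → 0ℚ ≤ p → 0ℚ ≤ q → 0ℚ ≤ p * q
  0≤* {p} {q} 0≤p 0≤q = subst (_≤ p * q) (*-zeroʳ p) (*-monoˡ-≤-nonNeg p {{nonNegative 0≤p}} 0≤q)

  *-mono-≤ : ∀ {p q r s} → 0ℚ ≤ p → 0ℚ ≤ r → p ≤ q → r ≤ s → p * r ≤ q * s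
  *-mono-≤ {p} {q} {r} {s} 0≤p 0≤r p≤q r≤s = ≤-trans
    (*-monoʳ-≤-nonNeg r {{nonNegative 0≤r}} p≤q)
    (*-monoˡ-≤-nonNeg q {{nonNegative (≤-trans 0≤p p≤q)}} r≤s)

  0<* : ∀ {p q} → 0ℚ < p → 0ℚ < q → 0ℚ < p * q
  0<* {p} {q} 0<p 0<q = positive⁻¹ (p * q) {{pos*pos⇒pos p {{positive 0<p}} q {{positive 0<q}}}}

  0≤square : ∀ p → 0ℚ ≤ p * p
  0≤square p with ≤-total 0ℚ p
  ... | inj₁ 0≤p = 0≤* 0≤p 0≤p
  ... | inj₂ p≤0 = subst (0ℚ ≤_) (solve 1 (λ p → (:- p) :* (:- p) := p :* p) refl p)
    (0≤* (neg-antimono-≤ p≤0) (neg-antimono-≤ p≤0))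

  divide : ∀ p q → 0ℚ < q → ∃[ r ] r * q ≡ p
  divide p q 0<q = p * 1/q , trans (*-assoc p 1/q q) (trans (cong (p *_) (*-inverseˡ q {{nz}})) (*-identityʳ p))
    where
    nz = pos⇒nonZero q {{positive 0<q}}
    1/q = (1/ q) {{nz}}

  ≤ι : ∀ p → ∃[ n ] p ≤ ι n
  ≤ι p@(mkℚ i d _) = ℤ.∣ i ∣ , toℚᵘ-cancel-≤ (ℚᵘ.≤-respʳ-≃ (ℚᵘ.≃-sym (toℚᵘ-ι ℤ.∣ i ∣))
    (ℚᵘ.*≤* (ℤ.≤-trans (ℤ.≤-reflexive (ℤ.*-identityʳ i)) (i≤ i))))
    where
    i≤ : ∀ i → i ℤ.≤ + ℤ.∣ i ∣ ℤ.* + suc d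
    i≤ (+ n)      = subst (+ n ℤ.≤_) (ℤ.pos-* n (suc d)) (ℤ.+≤+ (ℕ.m≤m*n n (suc d)))
    i≤ ℤ.-[1+ n ] = ℤ.-≤+

  archimedean : ∀ g C → 0ℚ < g → ∃[ T ] (∀ t → T ℕ.≤ t → C ≤ g * ι t)
  archimedean g C 0<g =
    let r , rg≡C = divide C g 0<g
        T , r≤T  = ≤ι r
    in T , λ t T≤t → subst₂ _≤_ rg≡C (*-comm (ι t) g)
         (*-monoʳ-≤-nonNeg g {{nonNegative (<⇒≤ 0<g)}} (≤-trans r≤T (ι-mono-≤ T≤t)))

  -- The exponential series

  pow : ℚ → ℕ → ℚ
  pow x zero    = 1ℚ
  pow x (suc n) = x * pow x n

  inv! : ℕ → ℚ
  inv! n = (+ 1 / (n !)) {{n ℕ.!≢0}}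

  expSum : ℚ → ℕ → ℚ
  expSum x zero    = 1ℚ
  expSum x (suc n) = expSum x n + pow x (suc n) * inv! (suc n)

  inv!*! : ∀ n → inv! n * ι (n !) ≡ 1ℚ
  inv!*! n with n ! | n ℕ.!≢0
  ... | suc k | _ = /-* 1 k

  0≤inv! : ∀ n → 0ℚ ≤ inv! n
  0≤inv! n = <⇒≤ (positive⁻¹ (inv! n) {{normalize-pos 1 (n !) {{n ℕ.!≢0}}}})

  inv!-suc : ∀ n → ι (suc n) * inv! (suc n) ≡ inv! n
  inv!-suc n = begin
    ι (suc n) * inv! (suc n)                       ≡⟨ *-identityʳ _ ⟨
    ι (suc n) * inv! (suc n) * 1ℚ                  ≡⟨ cong (ι (suc n) * inv! (suc n) *_) (inv!*! n) ⟨
    ι (suc n) * inv! (suc n) * (inv! n * ι (n !))     ≡⟨ solve 4 (λ s c′ c f → s :* c′ :* (c :* f) := c :* (c′ :* (s :* f)))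
        refl (ι (suc n)) (inv! (suc n)) (inv! n) (ι (n !)) ⟩
    inv! n * (inv! (suc n) * (ι (suc n) * ι (n !)))   ≡⟨ cong (λ f → inv! n * (inv! (suc n) * f)) (ι-* (suc n) (n !)) ⟨
    inv! n * (inv! (suc n) * ι (suc n !))             ≡⟨ cong (inv! n *_) (inv!*! (suc n)) ⟩
    inv! n * 1ℚ                                    ≡⟨ *-identityʳ (inv! n) ⟩
    inv! n                                         ∎
    where open ≡-Reasoning

  0≤pow : ∀ {x} n → 0ℚ ≤ x → 0ℚ ≤ pow x n
  0≤pow zero    0≤x = <⇒≤ (positive⁻¹ 1ℚ)
  0≤pow (suc n) 0≤x = 0≤* 0≤x (0≤pow n 0≤x)

  0≤pow-even : ∀ x n → 0ℚ ≤ pow x (n ℕ.+ n)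
  0≤pow-even x n = subst (0ℚ ≤_) (sym (pow-+ n n)) (0≤square (pow x n))
    where
    pow-+ : ∀ m n → pow x (m ℕ.+ n) ≡ pow x m * pow x n
    pow-+ zero    n = sym (*-identityˡ (pow x n))
    pow-+ (suc m) n = trans (cong (x *_) (pow-+ m n)) (sym (*-assoc x (pow x m) (pow x n)))

  1≤expSum : ∀ {x} n → 0ℚ ≤ x → 1ℚ ≤ expSum x n
  1≤expSum zero    0≤x = ≤-refl
  1≤expSum {x} (suc n) 0≤x = ≤-trans (1≤expSum n 0≤x)
    (by-difference _ (0≤* (0≤pow (suc n) 0≤x) (0≤inv! (suc n))) refl)

  expSum-0 : ∀ n → expSum 0ℚ n ≡ 1ℚ
  expSum-0 zero    = refl
  expSum-0 (suc n) = trans (cong₂ _+_ (expSum-0 n) (trans (cong (_* inv! (suc n)) (*-zeroˡ (pow 0ℚ n))) (*-zeroˡ (inv! (suc n)))))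
    (+-identityʳ 1ℚ)

  ∣pow∣≤ : ∀ {x B} n → ∣ x ∣ ≤ B → ∣ pow x n ∣ ≤ pow B n
  ∣pow∣≤ zero    _ = ≤-refl
  ∣pow∣≤ {x} (suc n) x≤B = subst (_≤ _) (sym (∣p*q∣≡∣p∣*∣q∣ x (pow x n)))
    (*-mono-≤ (0≤∣p∣ x) (0≤∣p∣ (pow x n)) x≤B (∣pow∣≤ n x≤B))

  -- It absorbs the factor n + 1 of a derivative into a power of 1 + B, so that later remainders sum
  -- to a partial exponential series at 1 + B. The two bounds are proved together because the
  -- induction step adds them.
  pow-1+ : ∀ {B} n → 0ℚ ≤ B → ι (suc n) * pow B n ≤ pow (1ℚ + B) (suc n) × pow B n ≤ pow (1ℚ + B) n
  pow-1+ {B} zero    0≤B = by-difference B 0≤B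
    (solve 1 (λ B → (con 1ℚ :+ B) :* con 1ℚ := con 1ℚ :* con 1ℚ :+ B) refl B) , ≤-refl
  pow-1+ {B} (suc n) 0≤B with pow-1+ n 0≤B
  ... | h₁ , h₂ = subst₂ _≤_ eq₁ eq₂ (+-mono-≤ (*-monoˡ-≤-nonNeg B {{nonNegative 0≤B}} h₁) h₃) , h₃
    where
    h₃ : pow B (suc n) ≤ pow (1ℚ + B) (suc n)
    h₃ = *-mono-≤ 0≤B (0≤pow n 0≤B) (by-difference 1ℚ (<⇒≤ (positive⁻¹ 1ℚ)) (+-comm 1ℚ B)) h₂
    eq₁ : B * (ι (suc n) * pow B n) + pow B (suc n) ≡ ι (suc (suc n)) * pow B (suc n)
    eq₁ = trans (solve 3 (λ B s p → B :* (s :* p) :+ B :* p := (con 1ℚ :+ s) :* (B :* p))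
        refl B (ι (suc n)) (pow B n))
                (cong (_* pow B (suc n)) (sym (ι-suc (suc n))))
    eq₂ : B * pow (1ℚ + B) (suc n) + pow (1ℚ + B) (suc n) ≡ pow (1ℚ + B) (suc (suc n))
    eq₂ = solve 2 (λ B p → B :* p :+ p := (con 1ℚ :+ B) :* p) refl B (pow (1ℚ + B) (suc n))

  -- Raising the exponent multiplies the remainder by w - a and adds a² times the derivative term (n
  -- + 1)wⁿ; the two contributions, bounded by B and by 1 times the same power, combine into one
  -- further factor 1 + B.
  taylor-remainder : ∀ {w a B} → ∣ w ∣ ≤ B → ∣ w - a ∣ ≤ B → ∀ n →
    ∣ pow (w - a) (suc n) - pow w (suc n) + ι (suc n) * (a * pow w n) ∣ ≤ a * a * pow (1ℚ + B) (suc n)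
  taylor-remainder {w} {a} {B} w≤B w-a≤B zero = subst (_≤ a * a * pow (1ℚ + B) 1)
    (sym (cong ∣_∣ (solve 2 (λ w a → (w :- a) :* con 1ℚ :- w :* con 1ℚ :+ con 1ℚ :* (a :* con 1ℚ) := con 0ℚ)
        refl w a)))
    (0≤* (0≤square a) (0≤pow 1 (0≤+ (<⇒≤ (positive⁻¹ 1ℚ)) (≤-trans (0≤∣p∣ w) w≤B))))
  taylor-remainder {w} {a} {B} w≤B w-a≤B (suc n) = begin
    ∣ pow (w - a) (suc (suc n)) - pow w (suc (suc n)) + ι (suc (suc n)) * (a * pow w (suc n)) ∣
      ≡⟨ cong (λ s → ∣ pow (w - a) (suc (suc n)) - pow w (suc (suc n)) + s * (a * pow w (suc n)) ∣) (ι-suc (suc n)) ⟩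
    ∣ (w - a) * P - w * (w * p) + (1ℚ + s) * (a * (w * p)) ∣
      ≡⟨ cong ∣_∣ (solve 5 (λ w a P p s → (w :- a) :* P :- w :* (w :* p) :+ (con 1ℚ :+ s) :* (a :* (w :* p))
           := (w :- a) :* (P :- w :* p :+ s :* (a :* p)) :+ a :* a :* (s :* p)) refl w a P p s) ⟩
    ∣ (w - a) * R + a * a * (s * p) ∣
      ≤⟨ ∣p+q∣≤∣p∣+∣q∣ ((w - a) * R) (a * a * (s * p)) ⟩
    ∣ (w - a) * R ∣ + ∣ a * a * (s * p) ∣
      ≡⟨ cong₂ _+_ (∣p*q∣≡∣p∣*∣q∣ (w - a) R) (trans (∣p*q∣≡∣p∣*∣q∣ (a * a) (s * p)) (cong₂ _*_ (0≤p⇒∣p∣≡p (0≤square a)) (trans (∣p*q∣≡∣p∣*∣q∣ s p) (cong (_* ∣ p ∣) (0≤p⇒∣p∣≡p (0≤ι (suc n))))))) ⟩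
    ∣ w - a ∣ * ∣ R ∣ + a * a * (s * ∣ p ∣)
      ≤⟨ +-mono-≤ (*-mono-≤ (0≤∣p∣ (w - a)) (0≤∣p∣ R) w-a≤B (taylor-remainder w≤B w-a≤B n))
           (*-monoˡ-≤-nonNeg (a * a) {{nonNegative (0≤square a)}}
             (≤-trans (*-monoˡ-≤-nonNeg s {{nonNegative (0≤ι (suc n))}} (∣pow∣≤ n w≤B)) (proj₁ (pow-1+ n 0≤B)))) ⟩
    B * (a * a * C) + a * a * C
      ≡⟨ solve 3 (λ B A C → B :* (A :* C) :+ A :* C := A :* ((con 1ℚ :+ B) :* C)) refl B (a * a) C ⟩
    a * a * pow (1ℚ + B) (suc (suc n)) ∎
    where
    open ≤-Reasoning
    P = pow (w - a) (suc n)
    p = pow w n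
    s = ι (suc n)
    R = P - w * p + s * (a * p)
    C = pow (1ℚ + B) (suc n)
    0≤B : 0ℚ ≤ B
    0≤B = ≤-trans (0≤∣p∣ w) w≤B

  -- The derivative of `expSum x n` in `x`, which loses the term of highest degree.
  expSum-pred : ℚ → ℕ → ℚ
  expSum-pred x zero    = 0ℚ
  expSum-pred x (suc n) = expSum x n

  expSum-pred+ : ∀ x n → expSum-pred x n + pow x n * inv! n ≡ expSum x n
  expSum-pred+ x zero    = refl
  expSum-pred+ x (suc n) = refl

  -∣p∣≤p : ∀ p → - ∣ p ∣ ≤ p
  -∣p∣≤p p with ∣p∣≡p∨∣p∣≡-p p
  ... | inj₁ eq = subst (λ q → - q ≤ p) (sym eq) (by-difference (p + p) (0≤+ 0≤p 0≤p)
                    (solve 1 (λ p → p := :- p :+ (p :+ p)) refl p))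
    where 0≤p = ∣p∣≡p⇒0≤p eq
  ... | inj₂ eq = ≤-reflexive (trans (cong -_ eq) (solve 1 (λ p → :- (:- p) := p) refl p))

  -- Tangent line at `w` with a quadratic error: the remainders of the powers, divided by
  -- factorials, sum to at most a² times the series at 1 + B.
  expSum-tangent : ∀ {w a B} → ∣ w ∣ ≤ B → ∣ w - a ∣ ≤ B → ∀ n →
    expSum w n - a * expSum-pred w n - a * a * expSum (1ℚ + B) n ≤ expSum (w - a) n
  expSum-tangent {w} {a} {B} w≤B w-a≤B zero = by-difference (a * a) (0≤square a)
    (solve 1 (λ a → con 1ℚ := con 1ℚ :- a :* con 0ℚ :- a :* a :* con 1ℚ :+ a :* a) refl a)
  expSum-tangent {w} {a} {B} w≤B w-a≤B (suc n) = by-difference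
    ((expSum (w - a) n - (expSum w n - a * expSum-pred w n - a * a * expSum (1ℚ + B) n)) + (R + a * a * C) * c′)
    (0≤+ (0≤difference (expSum-tangent w≤B w-a≤B n)) (0≤* (subst (0ℚ ≤_) (cong (λ z → R + z) (neg² (a * a * C)))
       (0≤difference (≤-trans (neg-antimono-≤ (taylor-remainder w≤B w-a≤B n)) (-∣p∣≤p R)))) (0≤inv! (suc n))))
    (begin
      expSum (w - a) n + P * c′
        ≡⟨ solve 11 (λ e P c′ f g h a p s wp C → e :+ P :* c′
             := (f :+ wp :* c′ :- a :* (g :+ p :* (s :* c′)) :- a :* a :* (h :+ C :* c′))
                :+ ((e :- (f :- a :* g :- a :* a :* h)) :+ ((P :- wp :+ s :* (a :* p)) :+ a :* a :* C) :* c′))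
             refl (expSum (w - a) n) P c′ (expSum w n) (expSum-pred w n) (expSum (1ℚ + B) n) a (pow w n) s (pow w (suc n)) C ⟩
      (expSum w (suc n) - a * (expSum-pred w n + pow w n * (s * c′)) - a * a * expSum (1ℚ + B) (suc n)) + D
        ≡⟨ cong (λ x → (expSum w (suc n) - a * x - a * a * expSum (1ℚ + B) (suc n)) + D)
             (trans (cong (λ y → expSum-pred w n + pow w n * y) (inv!-suc n)) (expSum-pred+ w n)) ⟩
      (expSum w (suc n) - a * expSum w n - a * a * expSum (1ℚ + B) (suc n)) + D ∎)
    where
    open ≡-Reasoning
    P = pow (w - a) (suc n)
    c′ = inv! (suc n)
    s = ι (suc n)
    R = P - pow w (suc n) + s * (a * pow w n)
    C = pow (1ℚ + B) (suc n)
    D = (expSum (w - a) n - (expSum w n - a * expSum-pred w n - a * a * expSum (1ℚ + B) n)) + (R + a * a * C) * c′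
    neg² : ∀ p → - (- p) ≡ p
    neg² = solve 1 (λ p → :- (:- p) := p) refl

  -- The derivative falls short of the partial sum by its last term w^N/N!. For even N this term is
  -- nonnegative whatever the sign of `w`, so the derivative may be replaced by the sum itself.
  expSum-tangent-even : ∀ {w a B} → 0ℚ ≤ a → ∣ w ∣ ≤ B → ∣ w - a ∣ ≤ B → ∀ n →
    (1ℚ - a) * expSum w (n ℕ.+ n) - a * a * expSum (1ℚ + B) (n ℕ.+ n) ≤ expSum (w - a) (n ℕ.+ n)
  expSum-tangent-even {w} {a} {B} 0≤a w≤B w-a≤B n = ≤-trans
    (by-difference (a * (pow w N * inv! N)) (0≤* 0≤a (0≤* (0≤pow-even w n) (0≤inv! N)))
      (trans (cong (λ e → e - a * expSum-pred w N - K) (sym (expSum-pred+ w N)))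
      (trans (solve 4 (λ a g t K → g :+ t :- a :* g :- K := (con 1ℚ :- a) :* (g :+ t) :- K :+ a :* t)
          refl a (expSum-pred w N) (pow w N * inv! N) K)
             (cong (λ e → (1ℚ - a) * e - K + a * (pow w N * inv! N)) (expSum-pred+ w N)))))
    (expSum-tangent w≤B w-a≤B N)
    where
    N = n ℕ.+ n
    K = a * a * expSum (1ℚ + B) N

  ∣p∣≤-negative : ∀ {p B} → p ≤ 0ℚ → - B ≤ p → ∣ p ∣ ≤ B
  ∣p∣≤-negative {p} {B} p≤0 -B≤p = subst₂ _≤_
    (trans (sym (0≤p⇒∣p∣≡p (neg-antimono-≤ p≤0))) (∣-p∣≡∣p∣ p))
    (solve 1 (λ B → :- (:- B) := B) refl B)
    (neg-antimono-≤ -B≤p)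

  -- The sum of the 2/(m + 2q) and its telescoping product.

  module Steps (m₀ d : ℕ) where

    m t : ℕ
    m = suc m₀
    t = m ℕ.+ (d ℕ.+ d)

    h : ℕ → ℚ
    h q = + 1 / (m ℕ.+ (q ℕ.+ q))

    a : ℕ → ℚ
    a q = ι 2 * h q

    A : ℕ → ℚ
    A zero    = 0ℚ
    A (suc q) = a q + A q

    h₀ : ℚ
    h₀ = + 1 / m

    -- `α` is 2/m, a common bound for all `a q`; `ρ` is d/m², a bound for the relative errors q/m²
    -- of the stages.
    α ρ : ℚ
    α = ι 2 * h₀
    ρ = ι d * (h₀ * h₀)

    h*m : h₀ * ι m ≡ 1ℚ
    h*m = /-* 1 m₀

    hq* : ∀ q → h q * ι (m ℕ.+ (q ℕ.+ q)) ≡ 1ℚ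
    hq* q = /-* 1 (m₀ ℕ.+ (q ℕ.+ q))

    0≤h : ∀ q → 0ℚ ≤ h q
    0≤h q = <⇒≤ (positive⁻¹ (h q) {{normalize-pos 1 (m ℕ.+ (q ℕ.+ q))}})

    0≤h₀ : 0ℚ ≤ h₀
    0≤h₀ = <⇒≤ (positive⁻¹ h₀ {{normalize-pos 1 m}})

    0≤ρ : 0ℚ ≤ ρ
    0≤ρ = 0≤* (0≤ι d) (0≤* 0≤h₀ 0≤h₀)

    h≤h₀ : ∀ q → h q ≤ h₀
    h≤h₀ q = *-cancelʳ-≤-pos (ι n) {{positive (0<ι (m₀ ℕ.+ (q ℕ.+ q)))}} (begin
      h q * ι n    ≡⟨ trans (hq* q) (sym h*m) ⟩
      h₀ * ι m     ≤⟨ *-monoˡ-≤-nonNeg h₀ {{nonNegative 0≤h₀}} (ι-mono-≤ (ℕ.m≤m+n m (q ℕ.+ q))) ⟩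
      h₀ * ι n     ∎)
      where
      open ≤-Reasoning
      n = m ℕ.+ (q ℕ.+ q)

    0≤a : ∀ q → 0ℚ ≤ a q
    0≤a q = 0≤* (0≤ι 2) (0≤h q)

    a≤α : ∀ q → a q ≤ α
    a≤α q = *-monoˡ-≤-nonNeg (ι 2) {{nonNegative (0≤ι 2)}} (h≤h₀ q)

    0≤A : ∀ q → 0ℚ ≤ A q
    0≤A zero    = ≤-refl
    0≤A (suc q) = 0≤+ (0≤a q) (0≤A q)

    A-mono : ∀ j q → A q ≤ A (j ℕ.+ q)
    A-mono zero    q = ≤-refl
    A-mono (suc j) q = ≤-trans (A-mono j q)
      (by-difference (a (j ℕ.+ q)) (0≤a (j ℕ.+ q)) (+-comm (a (j ℕ.+ q)) (A (j ℕ.+ q))))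

    A≤ : ∀ q → A q ≤ ι q * α
    A≤ zero    = ≤-reflexive (sym (*-zeroˡ α))
    A≤ (suc q) = subst (A (suc q) ≤_)
      (trans (solve 2 (λ α q → α :+ q :* α := (con 1ℚ :+ q) :* α) refl α (ι q)) (cong (_* α) (sym (ι-suc q))))
      (+-mono-≤ (a≤α q) (A≤ q))

    -- The numerators t, t − 2, …, m − 2 of the telescoping product ∏ (1 − a).
    D : ℕ → ℚ
    D q = ι (m ℕ.+ (q ℕ.+ q)) - ι 2

    D-suc : ∀ q → D (suc q) ≡ ι (m ℕ.+ (q ℕ.+ q))
    D-suc q = begin
      ι (m ℕ.+ (suc q ℕ.+ suc q)) - ι 2
        ≡⟨ cong (λ n → ι n - ι 2) (trans (cong (m ℕ.+_) (cong suc (ℕ.+-suc q q))) (trans (ℕ.+-suc m _) (cong suc (ℕ.+-suc m _)))) ⟩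
      ι (2 ℕ.+ (m ℕ.+ (q ℕ.+ q))) - ι 2          ≡⟨ cong (_- ι 2) (ι-+ 2 (m ℕ.+ (q ℕ.+ q))) ⟩
      ι 2 + ι (m ℕ.+ (q ℕ.+ q)) - ι 2            ≡⟨ solve 2 (λ x y → x :+ y :- x := y)
          refl (ι 2) (ι (m ℕ.+ (q ℕ.+ q))) ⟩
      ι (m ℕ.+ (q ℕ.+ q))                        ∎
      where open ≡-Reasoning

    D-step : ∀ q → D (suc q) - a q * D (suc q) ≡ D q
    D-step q = begin
      D (suc q) - a q * D (suc q)                ≡⟨ cong (λ x → x - a q * x) (D-suc q) ⟩
      x - ι 2 * h q * x
        ≡⟨ cong (λ y → x - y) (trans (*-assoc (ι 2) (h q) x) (cong (ι 2 *_) (hq* q))) ⟩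
      x - ι 2 * 1ℚ                               ≡⟨ cong (λ y → x - y) (*-identityʳ (ι 2)) ⟩
      x - ι 2                                    ∎
      where
      open ≡-Reasoning
      x = ι (m ℕ.+ (q ℕ.+ q))

    -- Each recorded inequality is divided by m²(m + 2q). The losses are doubled because `a q` is
    -- 2/(m + 2q).
    losses-bound : ∀ {b q s} → Losses m b q s → q ℕ.≤ suc d → ι 2 * ι s ≤ (1ℚ + ρ) * ι b * A q
    losses-bound {b} [] _ = ≤-reflexive (trans (*-zeroʳ (ι 2)) (sym (*-zeroʳ ((1ℚ + ρ) * ι b))))
    losses-bound {b} (step {q} {s} x small losses) (ℕ.s≤s q≤d) = subst₂ _≤_
      (trans (sym (*-distribˡ-+ (ι 2) (ι x) (ι s))) (cong (ι 2 *_) (sym (ι-+ x s))))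
      (solve 5 (λ two r b h A → two :* (r :* b :* h) :+ r :* b :* A := r :* b :* (two :* h :+ A))
         refl (ι 2) (1ℚ + ρ) (ι b) (h q) (A q))
      (+-mono-≤ (*-monoˡ-≤-nonNeg (ι 2) {{nonNegative (0≤ι 2)}} x≤) (losses-bound losses (ℕ.≤-trans q≤d (ℕ.n≤1+n d))))
      where
      open ≤-Reasoning
      n = m ℕ.+ (q ℕ.+ q)
      H = h₀ * h₀ * h q
      0≤H : 0ℚ ≤ H
      0≤H = 0≤* (0≤* 0≤h₀ 0≤h₀) (0≤h q)
      small′ : ι m * ι m * (ι n * ι x) ≤ (ι m * ι m + ι q) * ι b
      small′ = subst₂ _≤_
        (trans (ι-* (m ℕ.* m) (n ℕ.* x)) (cong₂ _*_ (ι-* m m) (ι-* n x)))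
        (trans (ι-* (m ℕ.* m ℕ.+ q) b) (cong (_* ι b) (trans (ι-+ (m ℕ.* m) q) (cong (_+ ι q) (ι-* m m)))))
        (ι-mono-≤ small)
      x≤ : ι x ≤ (1ℚ + ρ) * ι b * h q
      x≤ = begin
        ι x
          ≡⟨ solve 1 (λ x → x := con 1ℚ :* con 1ℚ :* (con 1ℚ :* x)) refl (ι x) ⟩
        1ℚ * 1ℚ * (1ℚ * ι x)
          ≡⟨ cong₂ (λ y z → y * y * (z * ι x)) h*m (hq* q) ⟨
        (h₀ * ι m) * (h₀ * ι m) * ((h q * ι n) * ι x)
          ≡⟨ solve 5 (λ h₀ m h n x → (h₀ :* m) :* (h₀ :* m) :* ((h :* n) :* x)
               := (h₀ :* h₀ :* h) :* (m :* m :* (n :* x))) refl h₀ (ι m) (h q) (ι n) (ι x) ⟩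
        H * (ι m * ι m * (ι n * ι x))
          ≤⟨ *-monoˡ-≤-nonNeg H {{nonNegative 0≤H}} small′ ⟩
        H * ((ι m * ι m + ι q) * ι b)
          ≡⟨ solve 5 (λ h₀ m h q b → h₀ :* h₀ :* h :* ((m :* m :+ q) :* b)
               := ((h₀ :* m) :* (h₀ :* m) :+ q :* (h₀ :* h₀)) :* b :* h) refl h₀ (ι m) (h q) (ι q) (ι b) ⟩
        ((h₀ * ι m) * (h₀ * ι m) + ι q * (h₀ * h₀)) * ι b * h q
          ≡⟨ cong (λ y → (y * y + ι q * (h₀ * h₀)) * ι b * h q) h*m ⟩
        (1ℚ + ι q * (h₀ * h₀)) * ι b * h q
          ≤⟨ *-monoʳ-≤-nonNeg (h q) {{nonNegative (0≤h q)}} (*-monoʳ-≤-nonNeg (ι b) {{nonNegative (0≤ι b)}}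
               (+-monoʳ-≤ 1ℚ (*-monoʳ-≤-nonNeg (h₀ * h₀) {{nonNegative (0≤* 0≤h₀ 0≤h₀)}} (ι-mono-≤ q≤d)))) ⟩
        (1ℚ + ρ) * ι b * h q ∎

    -- One factor of the product, with errors collected in `e`. The gain comes from the fact that (1
    -- - la)G exceeds (1 - a)(G + (1 - l)a) by a(1 - l)(G - 1 + a), which is nonnegative when G ≥ 1.
    single-step : ∀ {T e D a l G X X′ κ} → 0ℚ ≤ T → 0ℚ ≤ e → 0ℚ ≤ D → 0ℚ ≤ a → 0ℚ ≤ l → l ≤ 1ℚ →
      l * a ≤ 1ℚ → 1ℚ ≤ G → D * G - e ≤ T * X → (1ℚ - l * a) * X - κ ≤ X′ →
      (D - a * D) * (G + (1ℚ - l) * a) - (e + T * κ) ≤ T * X′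
    single-step {T} {e} {D} {a} {l} {G} {X} {X′} {κ} 0≤T 0≤e 0≤D 0≤a 0≤l l≤1 la≤1 1≤G ih e′ = by-difference
      (T * (X′ - ((1ℚ - l * a) * X - κ)) + (1ℚ - l * a) * (T * X - (D * G - e))
        + (a * D * (1ℚ - l) * ((G - 1ℚ) + a) + l * a * e))
      (0≤+ (0≤+ (0≤* 0≤T (0≤difference e′)) (0≤* (0≤difference la≤1) (0≤difference ih)))
           (0≤+ (0≤* (0≤* (0≤* 0≤a 0≤D) (0≤difference l≤1)) (0≤+ (0≤difference 1≤G) 0≤a)) (0≤* (0≤* 0≤l 0≤a) 0≤e)))
      (solve 9 (λ T e D a l G X X′ κ → T :* X′ :=
         ((D :- a :* D) :* (G :+ (con 1ℚ :- l) :* a) :- (e :+ T :* κ))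
         :+ (T :* (X′ :- ((con 1ℚ :- l :* a) :* X :- κ)) :+ (con 1ℚ :- l :* a) :* (T :* X :- (D :* G :- e))
           :+ (a :* D :* (con 1ℚ :- l) :* ((G :- con 1ℚ) :+ a) :+ l :* a :* e)))
         refl T e D a l G X X′ κ)

    module Path (n : ℕ) (B l : ℚ) (0≤l : 0ℚ ≤ l) (l≤1 : l ≤ 1ℚ) (lA≤B : l * A (suc d) ≤ B) (α≤1 : α ≤ 1ℚ)
      (0≤D₀ : 0ℚ ≤ D 0) where

      p N : ℕ
      p = suc d
      N = n ℕ.+ n

      M κ : ℚ
      M = expSum (1ℚ + B) N
      κ = α * α * M

      -- The exponent `W` runs from 0 at q = p down to -l A(p) at q = 0 and never leaves [-B, 0].
      -- Meanwhile `G` accumulates, from 1 to 1 + (1 - l) A(p), the gain from steps shortened by the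
      -- factor `l`.
      W G : ℕ → ℚ
      W q = l * (A q - A p)
      G q = 1ℚ + (1ℚ - l) * (A p - A q)

      0≤B : 0ℚ ≤ B
      0≤B = ≤-trans (0≤* 0≤l (0≤A p)) lA≤B

      0≤M : 0ℚ ≤ M
      0≤M = ≤-trans (<⇒≤ (positive⁻¹ 1ℚ)) (1≤expSum N (0≤+ (<⇒≤ (positive⁻¹ 1ℚ)) 0≤B))

      0≤α : 0ℚ ≤ α
      0≤α = 0≤* (0≤ι 2) 0≤h₀

      0≤D : ∀ q → 0ℚ ≤ D q
      0≤D zero    = 0≤D₀
      0≤D (suc q) = subst (0ℚ ≤_) (sym (D-suc q)) (0≤ι (m ℕ.+ (q ℕ.+ q)))

      A≤Ap : ∀ j q → j ℕ.+ q ≡ p → A q ≤ A p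
      A≤Ap j q eq = subst (λ i → A q ≤ A i) eq (A-mono j q)

      ∣W∣≤B : ∀ j q → j ℕ.+ q ≡ p → ∣ W q ∣ ≤ B
      ∣W∣≤B j q eq = ∣p∣≤-negative
        (by-difference (l * (A p - A q)) (0≤* 0≤l (0≤difference (A≤Ap j q eq)))
          (solve 3 (λ l x y → con 0ℚ := l :* (x :- y) :+ l :* (y :- x)) refl l (A q) (A p)))
        (by-difference (l * A q + (B - l * A p)) (0≤+ (0≤* 0≤l (0≤A q)) (0≤difference lA≤B))
          (solve 4 (λ l x y B → l :* (x :- y) := :- B :+ (l :* x :+ (B :- l :* y))) refl l (A q) (A p) B))

      la≤a : ∀ q → l * a q ≤ a q
      la≤a q = subst (l * a q ≤_) (*-identityˡ (a q)) (*-monoʳ-≤-nonNeg (a q) {{nonNegative (0≤a q)}} l≤1)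

      W-step : ∀ q → W (suc q) - l * a q ≡ W q
      W-step q = solve 4 (λ l a x y → l :* ((a :+ x) :- y) :- l :* a := l :* (x :- y))
          refl l (a q) (A q) (A p)

      path : ∀ j q → j ℕ.+ q ≡ p → D q * G q - ι j * (D p * κ) ≤ D p * expSum (W q) N
      path zero q refl = ≤-reflexive (begin
        D p * G p - ι 0 * (D p * κ)
          ≡⟨ solve 4 (λ D l A k → D :* (con 1ℚ :+ (con 1ℚ :- l) :* (A :- A)) :- con 0ℚ :* k := D :* con 1ℚ)
              refl (D p) l (A p) (D p * κ) ⟩
        D p * 1ℚ
          ≡⟨ cong (D p *_) (trans (cong (λ x → expSum x N) (trans (cong (l *_) (+-inverseʳ (A p))) (*-zeroʳ l))) (expSum-0 N)) ⟨
        D p * expSum (W p) N ∎)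
        where open ≡-Reasoning
      path (suc j) q eq = subst₂ (λ x y → x ≤ D p * expSum y N) eq₁ (W-step q)
        (single-step {κ = κ} (0≤D p) (0≤* (0≤ι j) (0≤* (0≤D p) (0≤* (0≤* 0≤α 0≤α) 0≤M))) (0≤D (suc q)) (0≤a q) 0≤l l≤1
          (≤-trans la≤α α≤1) 1≤G (path j (suc q) eq′) step-bound)
        where
        eq′ : j ℕ.+ suc q ≡ p
        eq′ = trans (ℕ.+-suc j q) eq
        la≤α : l * a q ≤ α
        la≤α = ≤-trans (la≤a q) (a≤α q)
        0≤la : 0ℚ ≤ l * a q
        0≤la = 0≤* 0≤l (0≤a q)
        1≤G : 1ℚ ≤ G (suc q)
        1≤G = by-difference _ (0≤* (0≤difference l≤1) (0≤difference (A≤Ap j (suc q) eq′))) refl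
        step-bound : (1ℚ - l * a q) * expSum (W (suc q)) N - κ ≤ expSum (W (suc q) - l * a q) N
        step-bound = ≤-trans
          (+-monoʳ-≤ ((1ℚ - l * a q) * expSum (W (suc q)) N) (neg-antimono-≤
            (*-monoʳ-≤-nonNeg M {{nonNegative 0≤M}} (*-mono-≤ 0≤la 0≤la la≤α la≤α))))
          (expSum-tangent-even 0≤la (∣W∣≤B j (suc q) eq′) (subst (λ w → ∣ w ∣ ≤ B) (sym (W-step q)) (∣W∣≤B (suc j) q eq)) n)
        eq₁ : (D (suc q) - a q * D (suc q)) * (G (suc q) + (1ℚ - l) * a q) - (ι j * (D p * κ) + D p * κ)
          ≡ D q * G q - ι (suc j) * (D p * κ)
        eq₁ = trans (cong₂ (λ x y → x * (G (suc q) + (1ℚ - l) * a q) - y) (D-step q)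
            (trans (solve 2 (λ j k → j :* k :+ k := (con 1ℚ :+ j) :* k)
                refl (ι j) (D p * κ)) (cong (_* (D p * κ)) (sym (ι-suc j)))))
          (cong (λ g → D q * g - ι (suc j) * (D p * κ))
            (solve 4 (λ l a x y → con 1ℚ :+ (con 1ℚ :- l) :* (y :- (a :+ x)) :+ (con 1ℚ :- l) :* a
               := con 1ℚ :+ (con 1ℚ :- l) :* (y :- x)) refl l (a q) (A q) (A p)))

      end : D 0 * (1ℚ + (1ℚ - l) * A p) - ι p * (D p * κ) ≤ D p * expSum (- (l * A p)) N
      end = subst₂ (λ x y → D 0 * (1ℚ + (1ℚ - l) * x) - ι p * (D p * κ) ≤ D p * expSum y N)
        (+-identityʳ (A p)) (solve 2 (λ l x → l :* (con 0ℚ :- x) := :- (l :* x)) refl l (A p))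
        (path p 0 (ℕ.+-identityʳ p))

    exp-lower-bound : ∀ n {B x ε} → ∣ x ∣ ≤ B → x ≤ 0ℚ → 0ℚ < ε → ε - x ≤ A (suc d) → α ≤ 1ℚ → 0ℚ ≤ D 0 →
      D 0 * (1ℚ + ε) - ι (suc d) * (ι t * (α * α * expSum (1ℚ + B) (n ℕ.+ n))) ≤ ι t * expSum x (n ℕ.+ n)
    exp-lower-bound n {B} {x} {ε} x≤B x≤0 0<ε ε-x≤A α≤1 0≤D₀ = subst₂ _≤_
        (cong (λ T → D 0 * (1ℚ + ε) - ι (suc d) * (T * (α * α * M))) (D-suc d))
        (cong₂ (λ T y → T * expSum y (n ℕ.+ n)) (D-suc d) -lA≡x)
        (≤-trans (+-monoˡ-≤ (- (ι (suc d) * (D (suc d) * (α * α * M))))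
                   (*-monoˡ-≤-nonNeg (D 0) {{nonNegative 0≤D₀}} (+-monoʳ-≤ 1ℚ ε≤)))
                 (Path.end n B l 0≤l l≤1 lA≤B α≤1 0≤D₀))
      where
      M = expSum (1ℚ + B) (n ℕ.+ n)
      Ap = A (suc d)
      0≤-x : 0ℚ ≤ - x
      0≤-x = neg-antimono-≤ x≤0
      0<Ap : 0ℚ < Ap
      0<Ap = <-≤-trans (subst (0ℚ <_) refl (+-mono-<-≤ 0<ε 0≤-x)) ε-x≤A
      quotient : ∃[ l ] l * Ap ≡ - x
      quotient = divide (- x) Ap 0<Ap
      l = proj₁ quotient
      lA≡-x = proj₂ quotient
      -lA≡x : - (l * Ap) ≡ x
      -lA≡x = trans (cong -_ lA≡-x) (solve 1 (λ x → :- (:- x) := x) refl x)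
      0≤l : 0ℚ ≤ l
      0≤l = *-cancelʳ-≤-pos Ap {{positive 0<Ap}} (subst₂ _≤_ (sym (*-zeroˡ Ap)) (sym lA≡-x) 0≤-x)
      -x≤Ap : - x ≤ Ap
      -x≤Ap = ≤-trans (by-difference ε (<⇒≤ 0<ε) (+-comm ε (- x))) ε-x≤A
      l≤1 : l ≤ 1ℚ
      l≤1 = *-cancelʳ-≤-pos Ap {{positive 0<Ap}} (subst₂ _≤_ (sym lA≡-x) (sym (*-identityˡ Ap)) -x≤Ap)
      lA≤B : l * Ap ≤ B
      lA≤B = subst (_≤ B) (trans (sym (∣-p∣≡∣p∣ x)) (trans (0≤p⇒∣p∣≡p 0≤-x) (sym lA≡-x))) x≤B
      ε≤ : ε ≤ (1ℚ - l) * Ap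
      ε≤ = subst (ε ≤_) (trans (cong (λ y → Ap - y) (sym lA≡-x)) (solve 2 (λ l A → A :- l :* A := (con 1ℚ :- l) :* A)
          refl l Ap))
        (by-difference (Ap - (ε - x)) (0≤difference ε-x≤A) (solve 3 (λ A e x → A :- (:- x) := e :+ (A :- (e :- x)))
            refl Ap ε x))

  -- The threshold depends only on η, ε, n and B. It is uniform in σ and x, which will be the
  -- approximations of 1 - 2c and of its logarithm at a varying index.
  analysis : ∀ η ε n B → 0ℚ < η → 0ℚ < ε → ∃[ t₀ ] (∀ m₀ d → let open Steps m₀ d in t₀ ℕ.≤ t →
    ∀ {σ x} → η ≤ σ → σ * ι t - ι 4 ≤ D 0 → ∣ x ∣ ≤ B → x ≤ 0ℚ → expSum x (n ℕ.+ n) ≤ σ + η * ε * ½ →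
    A (suc d) ≤ ε - x × ρ * A (suc d) ≤ ε)
  analysis η ε n B 0<η 0<ε = T₁ ℕ.⊔ (T₂ ℕ.⊔ T₃) , λ m₀ d t₀≤t η≤σ σt-4≤D₀ x≤B x≤0 upper →
    let t₁ = ℕ.m⊔n≤o⇒m≤o T₁ (T₂ ℕ.⊔ T₃) t₀≤t
        t₂₃ = ℕ.m⊔n≤o⇒n≤o T₁ (T₂ ℕ.⊔ T₃) t₀≤t
        open Large m₀ d (h₁ _ t₁) (h₂ _ (ℕ.m⊔n≤o⇒m≤o T₂ T₃ t₂₃)) (h₃ _ (ℕ.m⊔n≤o⇒n≤o T₂ T₃ t₂₃)) η≤σ σt-4≤D₀
    in first x≤B x≤0 upper , second
    where
    M η³ C : ℚ
    M  = expSum (1ℚ + B) (n ℕ.+ n)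
    η³ = η * η * η
    C  = ι 4 * (1ℚ + ε) * (η * η) + ι 16 * M
    0<η³ : 0ℚ < η³
    0<η³ = 0<* (0<* 0<η 0<η) 0<η
    0≤η : 0ℚ ≤ η
    0≤η = <⇒≤ 0<η
    0≤ε : 0ℚ ≤ ε
    0≤ε = <⇒≤ 0<ε
    -- The three thresholds: the first gives m ≥ ηt/2, the second contradicts an exponential that is
    -- too large, the third makes ρA small.
    step₁ : ∃[ T ] (∀ t → T ℕ.≤ t → ι 4 ≤ η * ι t)
    step₁ = archimedean η (ι 4) 0<η
    step₂ : ∃[ T ] (∀ t → T ℕ.≤ t → C + 1ℚ ≤ η³ * ε * ½ * ι t)
    step₂ = archimedean (η³ * ε * ½) (C + 1ℚ) (0<* (0<* 0<η³ 0<ε) (positive⁻¹ ½))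
    step₃ : ∃[ T ] (∀ t → T ℕ.≤ t → ι 16 ≤ ε * η³ * ι t)
    step₃ = archimedean (ε * η³) (ι 16) (0<* 0<ε 0<η³)
    T₁ = proj₁ step₁
    T₂ = proj₁ step₂
    T₃ = proj₁ step₃
    h₁ = proj₂ step₁
    h₂ = proj₂ step₂
    h₃ = proj₂ step₃

    module Large (m₀ d : ℕ) (t₁ : ι 4 ≤ η * ι (Steps.t m₀ d)) (t₂ : C + 1ℚ ≤ η³ * ε * ½ * ι (Steps.t m₀ d))
      (t₃ : ι 16 ≤ ε * η³ * ι (Steps.t m₀ d))
      {σ : ℚ} (η≤σ : η ≤ σ) (σt-4≤D₀ : σ * ι (Steps.t m₀ d) - ι 4 ≤ Steps.D m₀ d 0) where

      open Steps m₀ d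

      τ : ℚ
      τ = ι t
      0≤τ : 0ℚ ≤ τ
      0≤τ = 0≤ι t
      p : ℕ
      p = suc d
      p≤t : ι p ≤ τ
      p≤t = ι-mono-≤ (ℕ.s≤s (ℕ.≤-trans (ℕ.m≤m+n d d) (ℕ.m≤n+m (d ℕ.+ d) m₀)))
      ητ≤στ : η * τ ≤ σ * τ
      ητ≤στ = *-monoʳ-≤-nonNeg τ {{nonNegative 0≤τ}} η≤σ
      0≤D₀ : 0ℚ ≤ D 0
      0≤D₀ = ≤-trans (0≤difference (≤-trans t₁ ητ≤στ)) σt-4≤D₀
      D₀≡ : D 0 ≡ ι m - ι 2
      D₀≡ = cong (λ k → ι k - ι 2) (ℕ.+-identityʳ m)
      ητ≤2m : η * τ ≤ ι 2 * ι m
      ητ≤2m = by-difference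
        (ι 2 * (ι m - ι 2 - (σ * τ - ι 4)) + ((η * τ - ι 4) + ι 2 * (σ * τ - η * τ)))
        (0≤+ (0≤* (0≤ι 2) (0≤difference (subst (σ * τ - ι 4 ≤_) D₀≡ σt-4≤D₀)))
             (0≤+ (0≤difference t₁) (0≤* (0≤ι 2) (0≤difference ητ≤στ))))
        (solve 3 (λ m y s → con (ι 2) :* m := y :+ (con (ι 2) :* (m :- con (ι 2) :- (s :- con (ι 4)))
            :+ ((y :- con (ι 4)) :+ con (ι 2) :* (s :- y)))) refl (ι m) (η * τ) (σ * τ))
      -- The ratio ηt/m, at most 2. Error terms are rewritten through it so that `m` disappears from
      -- the estimates.
      u : ℚ
      u = h₀ * (η * τ)
      0≤u : 0ℚ ≤ u
      0≤u = 0≤* 0≤h₀ (0≤* 0≤η 0≤τ)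
      u≤2 : u ≤ ι 2
      u≤2 = ≤-trans (*-monoˡ-≤-nonNeg h₀ {{nonNegative 0≤h₀}} ητ≤2m) (≤-reflexive
        (trans (solve 3 (λ h x m → h :* (x :* m) := x :* (h :* m)) refl h₀ (ι 2) (ι m))
        (trans (cong (ι 2 *_) h*m) (*-identityʳ (ι 2)))))
      α≤1 : α ≤ 1ℚ
      α≤1 = subst₂ _≤_ (*-comm h₀ (ι 2)) h*m (*-monoˡ-≤-nonNeg h₀ {{nonNegative 0≤h₀}}
        (by-difference (ι m - ι 2) (subst (0ℚ ≤_) D₀≡ 0≤D₀) (solve 2 (λ x y → x := y :+ (x :- y))
            refl (ι m) (ι 2))))

      first : ∀ {x} → ∣ x ∣ ≤ B → x ≤ 0ℚ → expSum x (n ℕ.+ n) ≤ σ + η * ε * ½ → A p ≤ ε - x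
      first {x} x≤B x≤0 upper with ≤-total (A p) (ε - x)
      ... | inj₁ ok = ok
      -- If A were this large, t exp x would be at least (σt - 4)(1 + ε) - K. Against the upper
      -- bound t(σ + ηε/2) this leaves ηεt/2 ≤ 4(1 + ε) + K with K bounded, impossible for large t.
      ... | inj₂ ε-x≤A = ⊥-elim (<-irrefl refl (<-≤-trans
              (subst (_< C + 1ℚ) (+-identityʳ C) (+-monoʳ-< C (positive⁻¹ 1ℚ))) (≤-trans t₂ absurd)))
        where
        X = expSum x (n ℕ.+ n)
        K = ι p * (τ * (α * α * M))
        0≤B : 0ℚ ≤ B
        0≤B = ≤-trans (0≤∣p∣ x) x≤B
        0≤M : 0ℚ ≤ M
        0≤M = ≤-trans (<⇒≤ (positive⁻¹ 1ℚ)) (1≤expSum (n ℕ.+ n) (0≤+ (<⇒≤ (positive⁻¹ 1ℚ)) 0≤B))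
        lower : D 0 * (1ℚ + ε) - K ≤ τ * X
        lower = exp-lower-bound n x≤B x≤0 0<ε ε-x≤A α≤1 0≤D₀
        main : η * ε * ½ * τ ≤ ι 4 * (1ℚ + ε) + K
        main = by-difference
          (τ * (σ + η * ε * ½ - X) + (τ * X - (D 0 * (1ℚ + ε) - K)) +
            ((D 0 - (σ * τ - ι 4)) * (1ℚ + ε) + (σ * τ - η * τ) * ε))
          (0≤+ (0≤+ (0≤* 0≤τ (0≤difference upper)) (0≤difference lower))
               (0≤+ (0≤* (0≤difference σt-4≤D₀) (0≤+ (<⇒≤ (positive⁻¹ 1ℚ)) 0≤ε)) (0≤* (0≤difference ητ≤στ) 0≤ε)))
          (solve 7 (λ t s y e X D K → con (ι 4) :* (con 1ℚ :+ e) :+ K :=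
             y :* e :* con ½ :* t :+ (t :* (s :+ y :* e :* con ½ :- X) :+ (t :* X :- (D :* (con 1ℚ :+ e) :- K)) :+
               ((D :- (s :* t :- con (ι 4))) :* (con 1ℚ :+ e) :+ (s :* t :- y :* t) :* e)))
             refl τ σ η ε X (D 0) K)
        -- The total error stays bounded: at most t steps, each contributing t(2/m)²M, amount to
        -- 4u²M after multiplication by η².
        ηηK≤ : η * η * K ≤ ι 16 * M
        ηηK≤ = begin
          η * η * K
            ≤⟨ *-monoˡ-≤-nonNeg (η * η) {{nonNegative (0≤square η)}} (*-monoʳ-≤-nonNeg _
                 {{nonNegative (0≤* 0≤τ (0≤* (0≤square α) 0≤M))}} p≤t) ⟩
          η * η * (τ * (τ * (α * α * M)))
            ≡⟨ solve 4 (λ y t h M → y :* y :* (t :* (t :* (con (ι 2) :* h :* (con (ι 2) :* h) :* M)))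
                 := con (ι 4) :* ((h :* (y :* t)) :* (h :* (y :* t))) :* M) refl η τ h₀ M ⟩
          ι 4 * (u * u) * M
            ≤⟨ *-monoʳ-≤-nonNeg M {{nonNegative 0≤M}} (*-monoˡ-≤-nonNeg (ι 4) {{nonNegative (0≤ι 4)}}
                 (*-mono-≤ 0≤u 0≤u u≤2 u≤2)) ⟩
          ι 16 * M ∎
          where open ≤-Reasoning
        absurd : η³ * ε * ½ * τ ≤ C
        absurd = begin
          η³ * ε * ½ * τ                            ≡⟨ solve 4 (λ y e x t → y :* y :* y :* e :* x :* t := y :* y :* (y :* e :* x :* t))
              refl η ε ½ τ ⟩
          η * η * (η * ε * ½ * τ)                   ≤⟨ *-monoˡ-≤-nonNeg (η * η) {{nonNegative (0≤square η)}} main ⟩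
          η * η * (ι 4 * (1ℚ + ε) + K)              ≡⟨ solve 3 (λ y z K → y :* (z :+ K) := z :* y :+ y :* K)
              refl (η * η) (ι 4 * (1ℚ + ε)) K ⟩
          ι 4 * (1ℚ + ε) * (η * η) + η * η * K      ≤⟨ +-monoʳ-≤ (ι 4 * (1ℚ + ε) * (η * η)) ηηK≤ ⟩
          C ∎
          where open ≤-Reasoning

      second : ρ * A p ≤ ε
      second = *-cancelʳ-≤-pos (η³ * τ) {{positive (0<* 0<η³ (0<ι (m₀ ℕ.+ (d ℕ.+ d))))}} (begin
        ρ * A p * (η³ * τ)
          ≤⟨ *-monoʳ-≤-nonNeg (η³ * τ) {{nonNegative 0≤η³τ}} (*-mono-≤ 0≤ρ (0≤A p) ρ≤ A≤τα) ⟩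
        (τ * (h₀ * h₀)) * (τ * α) * (η³ * τ)
          ≡⟨ solve 3 (λ t h y → (t :* (h :* h)) :* (t :* (con (ι 2) :* h)) :* (y :* y :* y :* t)
               := con (ι 2) :* ((h :* (y :* t)) :* ((h :* (y :* t)) :* (h :* (y :* t))))) refl τ h₀ η ⟩
        ι 2 * (u * (u * u))
          ≤⟨ *-monoˡ-≤-nonNeg (ι 2) {{nonNegative (0≤ι 2)}} (*-mono-≤ 0≤u (0≤* 0≤u 0≤u) u≤2 (*-mono-≤ 0≤u 0≤u u≤2 u≤2)) ⟩
        ι 16
          ≤⟨ t₃ ⟩
        ε * η³ * τ
          ≡⟨ *-assoc ε η³ τ ⟩
        ε * (η³ * τ) ∎)
        where
        open ≤-Reasoning
        0≤η³τ : 0ℚ ≤ η³ * τ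
        0≤η³τ = 0≤* (<⇒≤ 0<η³) 0≤τ
        d≤t : ι d ≤ τ
        d≤t = ≤-trans (ι-mono-≤ (ℕ.n≤1+n d)) p≤t
        ρ≤ : ρ ≤ τ * (h₀ * h₀)
        ρ≤ = *-monoʳ-≤-nonNeg (h₀ * h₀) {{nonNegative (0≤* 0≤h₀ 0≤h₀)}} d≤t
        0≤α : 0ℚ ≤ α
        0≤α = 0≤* (0≤ι 2) 0≤h₀
        A≤τα : A p ≤ τ * α
        A≤τα = ≤-trans (A≤ p) (*-monoʳ-≤-nonNeg α {{nonNegative 0≤α}} p≤t)

  -- From real numbers to their rational approximations.

  seq-^ : ∀ x n j → seq (x R.^ n) j ≡ pow (seq x j) n
  seq-^ x zero    j = refl
  seq-^ x (suc n) j = cong (seq x j *_) (seq-^ x n j)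

  seq-exp : ∀ x n j → seq (expPartialSum x n) j ≡ expSum (seq x j) n
  seq-exp x zero    j = refl
  seq-exp x (suc n) j = cong₂ (λ e p → e + p * inv! (suc n)) (seq-exp x n j) (seq-^ x (suc n) j)

  bounded : ∀ x → ∃[ B ] ∃[ J ] (∀ j → J ℕ.≤ j → ∣ seq x j ∣ ≤ B)
  bounded x =
    let J , h = cauchy x 1ℚ (positive⁻¹ 1ℚ)
    in 1ℚ + ∣ seq x J ∣ , J , λ j J≤j → begin
      ∣ seq x j ∣                        ≡⟨ cong ∣_∣ (solve 2 (λ a b → a := (a :- b) :+ b)
          refl (seq x j) (seq x J)) ⟩
      ∣ (seq x j - seq x J) + seq x J ∣  ≤⟨ ∣p+q∣≤∣p∣+∣q∣ (seq x j - seq x J) (seq x J) ⟩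
      ∣ seq x j - seq x J ∣ + ∣ seq x J ∣ ≤⟨ +-monoˡ-≤ ∣ seq x J ∣ (h j J J≤j ℕ.≤-refl) ⟩
      1ℚ + ∣ seq x J ∣                   ∎
    where open ≤-Reasoning

  -- Here d = t - ω, and the strict inequality says that m = 2ω - t is at least 2, whence m = o + 2.
  decompose : ∀ {t ω} → ω ℕ.≤ t → suc t ℕ.< ω ℕ.+ ω →
    ∃[ o ] ∃[ d ] ω ≡ suc (suc o) ℕ.+ d × t ≡ suc (suc o) ℕ.+ (d ℕ.+ d)
  decompose {t} {ω} ω≤t t<ω+ω with ℕ.m≤n⇒∃[o]m+o≡n ω≤t
  ... | d , refl with ℕ.m≤n⇒∃[o]m+o≡n {suc (suc d)} {ω}
    (ℕ.+-cancelˡ-≤ ω (suc (suc d)) ω (subst (ℕ._≤ ω ℕ.+ ω) (trans (cong suc (sym (ℕ.+-suc ω d))) (sym (ℕ.+-suc ω (suc d)))) t<ω+ω))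
  ...   | o , refl = o , d , cong (λ n → suc (suc n)) (ℕ.+-comm d o) ,
    cong (λ n → suc (suc n)) (trans (cong (ℕ._+ d) (ℕ.+-comm d o)) (ℕ.+-assoc o d d))

  module Limit (c₀ : ℝ) (0<c : fromℕ 0 R.< c₀) (c<½ : c₀ R.< fromℚ ½)
    (ℓ : ℝ) (log : IsLog (fromℕ 1 R.- fromℕ 2 R.* c₀) ℓ) (ε₀ : ℝ) (0<ε₀ : fromℕ 0 R.< ε₀) where

    -- Rational gaps of the strict hypotheses; η = 2δ bounds 1 - 2c from below. The minimum with `γ`
    -- forces the approximations of ℓ to be nonpositive: the partial sum is at most 1 - 2c + γ < 1,
    -- whereas at a nonnegative argument it is at least 1.
    γ δ η ε ε₁ : ℚ
    γ  = proj₁ 0<c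
    δ  = proj₁ c<½
    η  = δ + δ
    ε  = proj₁ 0<ε₀
    ε₁ = (η * ε * ½) ⊓ γ

    0<γ : 0ℚ < γ
    0<γ = proj₁ (proj₂ 0<c)

    0<η : 0ℚ < η
    0<η = +-mono-< (proj₁ (proj₂ c<½)) (proj₁ (proj₂ c<½))

    0<ε : 0ℚ < ε
    0<ε = proj₁ (proj₂ 0<ε₀)

    0<ε₁ : 0ℚ < ε₁
    0<ε₁ with ⊓-sel (η * ε * ½) γ
    ... | inj₁ eq = subst (0ℚ <_) (sym eq) (0<* (0<* 0<η 0<ε) (positive⁻¹ ½))
    ... | inj₂ eq = subst (0ℚ <_) (sym eq) 0<γ

    convergence : ∃[ N ] (∀ n → N ℕ.≤ n →
      expPartialSum ℓ n R.< (fromℕ 1 R.- fromℕ 2 R.* c₀) R.+ fromℚ ε₁ × _)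
    convergence = log (fromℚ ε₁) (ε₁ , 0<ε₁ , 0 , λ _ _ → ≤-reflexive (+-identityˡ ε₁))

    n : ℕ
    n = proj₁ convergence

    -- The even order n + n is the one for which the tangent bound holds without a condition on the
    -- sign of the exponent.
    close : expPartialSum ℓ (n ℕ.+ n) R.< (fromℕ 1 R.- fromℕ 2 R.* c₀) R.+ fromℚ ε₁
    close = proj₁ (proj₂ convergence (n ℕ.+ n) (ℕ.m≤m+n n n))

    B : ℚ
    B = proj₁ (bounded ℓ)

    large : ∃[ T ] (∀ t → T ℕ.≤ t → ι 4 ≤ η * ι t)
    large = archimedean η (ι 4) 0<η

    t₁ t₀ : ℕ
    t₁ = proj₁ (analysis η ε n B 0<η 0<ε)
    t₀ = t₁ ℕ.⊔ proj₁ large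

    -- From this index on, the approximations satisfy all hypotheses with their uniform gaps, and
    -- the argument takes place among rationals at a single index.
    J₀ : ℕ
    J₀ = proj₁ (proj₂ (proj₂ 0<c)) ℕ.⊔ (proj₁ (proj₂ (proj₂ c<½)) ℕ.⊔ (proj₁ (proj₂ (proj₂ 0<ε₀)) ℕ.⊔
      (proj₁ (proj₂ (proj₂ close)) ℕ.⊔ proj₁ (proj₂ (bounded ℓ)))))

    module At (j : ℕ) (J₀≤j : J₀ ℕ.≤ j) where

      private
        a₁ = proj₁ (proj₂ (proj₂ 0<c))
        a₂ = proj₁ (proj₂ (proj₂ c<½))
        a₃ = proj₁ (proj₂ (proj₂ 0<ε₀))
        a₄ = proj₁ (proj₂ (proj₂ close))
        a₅ = proj₁ (proj₂ (bounded ℓ))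
        b₂ = ℕ.m⊔n≤o⇒n≤o a₁ (a₂ ℕ.⊔ (a₃ ℕ.⊔ (a₄ ℕ.⊔ a₅))) J₀≤j
        b₃ = ℕ.m⊔n≤o⇒n≤o a₂ (a₃ ℕ.⊔ (a₄ ℕ.⊔ a₅)) b₂
        b₄ = ℕ.m⊔n≤o⇒n≤o a₃ (a₄ ℕ.⊔ a₅) b₃

      cⱼ σ x : ℚ
      cⱼ = seq c₀ j
      σ  = ι 1 - ι 2 * cⱼ
      x  = seq ℓ j

      γ≤c : γ ≤ cⱼ
      γ≤c = subst (_≤ cⱼ) (+-identityˡ γ) (proj₂ (proj₂ (proj₂ 0<c)) j (ℕ.m⊔n≤o⇒m≤o a₁ _ J₀≤j))

      η≤σ : η ≤ σ
      η≤σ = by-difference (ι 2 * (½ - (cⱼ + δ)))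
        (0≤* (0≤ι 2) (0≤difference (proj₂ (proj₂ (proj₂ c<½)) j (ℕ.m⊔n≤o⇒m≤o a₂ _ b₂))))
        (solve 2 (λ c d → con (ι 1) :- con (ι 2) :* c := (d :+ d) :+ con (ι 2) :* (con ½ :- (c :+ d)))
            refl cⱼ δ)

      ε≤εⱼ : ε ≤ seq ε₀ j
      ε≤εⱼ = subst (_≤ seq ε₀ j) (+-identityˡ ε) (proj₂ (proj₂ (proj₂ 0<ε₀)) j (ℕ.m⊔n≤o⇒m≤o a₃ _ b₃))

      expSum≤ : expSum x (n ℕ.+ n) ≤ σ + ε₁
      expSum≤ = ≤-trans (by-difference (proj₁ close) (<⇒≤ (proj₁ (proj₂ close))) refl)
        (subst (λ e → e + proj₁ close ≤ σ + ε₁) (seq-exp ℓ (n ℕ.+ n) j)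
          (proj₂ (proj₂ (proj₂ close)) j (ℕ.m⊔n≤o⇒m≤o a₄ _ b₄)))

      ∣x∣≤B : ∣ x ∣ ≤ B
      ∣x∣≤B = proj₂ (proj₂ (bounded ℓ)) j (ℕ.m⊔n≤o⇒n≤o a₄ a₅ b₄)

      x≤0 : x ≤ 0ℚ
      x≤0 with ≤-total x 0ℚ
      ... | inj₁ x≤0 = x≤0
      ... | inj₂ 0≤x = ⊥-elim (<-irrefl refl (<-≤-trans 0<γ (by-difference
              ((σ + ε₁ - 1ℚ) + (γ - ε₁) + ι 2 * (cⱼ - γ))
              (0≤+ (0≤+ (0≤difference (≤-trans (1≤expSum (n ℕ.+ n) 0≤x) expSum≤)) (0≤difference (p⊓q≤q (η * ε * ½) γ)))
                   (0≤* (0≤ι 2) (0≤difference γ≤c)))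
              (solve 3 (λ g c e → con 0ℚ := g :+ ((con (ι 1) :- con (ι 2) :* c :+ e :- con 1ℚ) :+ (g :- e) :+ con (ι 2) :* (c :- g)))
                 refl γ cⱼ ε₁))))

    -- The slack ½ in the comparison of approximations still gives ω < t + 1, and ω and t are
    -- integers.
    floor-≤ : ∀ {t ω} → IsFloor ((fromℕ 1 R.- c₀) R.* fromℕ t) ω → ω ℕ.≤ t
    floor-≤ {t} {ω} (lower , _) =
      let K , h = lower ½ (positive⁻¹ ½)
          j = J₀ ℕ.⊔ K
          open At j (ℕ.m≤m⊔n J₀ K)
      in ℕ.s≤s⁻¹ (ι-cancel-< (subst (ι ω <_) (sym (ι-suc t)) (≤-<-trans (h j (ℕ.m≤n⊔m J₀ K))
        (≤-<-trans (by-difference (cⱼ * ι t) (0≤* (≤-trans (<⇒≤ 0<γ) γ≤c) (0≤ι t))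
            (solve 2 (λ c t → con ½ :+ t := (con (ι 1) :+ :- c) :* t :+ con ½ :+ c :* t) refl cⱼ (ι t)))
          (+-monoˡ-< (ι t) {½} {1ℚ} (*<* (ℤ.+<+ (ℕ.s≤s (ℕ.s≤s ℕ.z≤n)))))))))

    -- From ω > (1 - c)t - 1 follows 2ω - t > (1 - 2c)t - 2, a lower bound for m.
    floor-> : ∀ {t ω} → IsFloor ((fromℕ 1 R.- c₀) R.* fromℕ t) ω →
      ∃[ K ] (∀ j → J₀ ℕ.≤ j → K ℕ.≤ j → (ι 1 - ι 2 * seq c₀ j) * ι t ≤ ι ω + ι ω - ι t + ι 2)
    floor-> {t} {ω} (_ , δ′ , 0<δ′ , K , h) = K , λ j J₀≤j K≤j → by-difference
      (ι 2 * (ι ω + ι 1 - ((ι 1 - seq c₀ j) * ι t + δ′)) + ι 2 * δ′)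
      (0≤+ (0≤* (0≤ι 2) (0≤difference (h j K≤j))) (0≤* (0≤ι 2) (<⇒≤ 0<δ′)))
      (solve 4 (λ c t w d → w :+ w :- t :+ con (ι 2) := (con (ι 1) :- con (ι 2) :* c) :* t :+
          (con (ι 2) :* (w :+ con (ι 1) :- ((con (ι 1) :- c) :* t :+ d)) :+ con (ι 2) :* d))
        refl (seq c₀ j) (ι t) (ι ω) δ′)

    -- The previous bound gives 2ω ≥ t + ηt - 2, and ηt ≥ 4 for large t.
    floor-half : ∀ {t ω} → t₀ ℕ.≤ t → IsFloor ((fromℕ 1 R.- c₀) R.* fromℕ t) ω → suc t ℕ.< ω ℕ.+ ω
    floor-half {t} {ω} t₀≤t floor =
      let K , h = floor-> {t} {ω} floor
          j = J₀ ℕ.⊔ K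
          open At j (ℕ.m≤m⊔n J₀ K)
          4≤ηt = proj₂ large t (ℕ.m⊔n≤o⇒n≤o t₁ (proj₁ large) t₀≤t)
      in ι-cancel-< (<-≤-trans (subst (_< ι 2 + ι t) (sym (ι-suc t)) (+-monoˡ-< (ι t) {1ℚ} {ι 2} (*<* (ℤ.+<+ (ℕ.s≤s (ℕ.s≤s ℕ.z≤n))))))
        (by-difference ((ι ω + ι ω - ι t + ι 2 - σ * ι t) + ((σ * ι t - η * ι t) + (η * ι t - ι 4)))
          (0≤+ (0≤difference (h j (ℕ.m≤m⊔n J₀ K) (ℕ.m≤n⊔m J₀ K)))
            (0≤+ (0≤difference (*-monoʳ-≤-nonNeg (ι t) {{nonNegative (0≤ι t)}} η≤σ)) (0≤difference 4≤ηt)))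
          (trans (ι-+ ω ω) (solve 4 (λ w t s y → w :+ w := con (ι 2) :+ t :+
             ((w :+ w :- t :+ con (ι 2) :- s) :+ ((s :- y) :+ (y :- con (ι 4))))) refl (ι ω) (ι t) (σ * ι t) (η * ι t)))))

    lower-bound : ℝ → ℕ → ℝ
    lower-bound ε t = ((fromℕ t R.+ fromℕ 1) R.+ fromℚ ½ R.* ℓ) R.- ε

    -- The losses satisfy s/b ≤ (1 + ρ)A/2 ≤ -x/2 + ε, where one half of ε pays for A and the other
    -- for ρA. Subtracting from t + 1 leaves t + 1 + x/2 - ε.
    chromatic-bound : ∀ m₀ d → let open Steps m₀ d in t₀ ℕ.≤ t →
      IsFloor ((fromℕ 1 R.- c₀) R.* fromℕ t) (m ℕ.+ d) →
      ∃[ K ] (∀ j → K ℕ.≤ j → ∀ {b k s} → Losses m (suc b) (suc d) s → suc b ℕ.* suc t ℕ.≤ k ℕ.+ s →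
        seq (lower-bound ε₀ t) j ≤ + k / suc b)
    chromatic-bound m₀ d t₀≤t floor = J₀ ℕ.⊔ K , bound
      where
      open Steps m₀ d
      K = proj₁ (floor-> {t} {m ℕ.+ d} floor)
      module _ (j : ℕ) (K≤j : J₀ ℕ.⊔ K ℕ.≤ j) {b k s : ℕ}
        (losses : Losses m (suc b) (suc d) s) (covered : suc b ℕ.* suc t ℕ.≤ k ℕ.+ s) where
        open At j (ℕ.m⊔n≤o⇒m≤o J₀ K K≤j)
        β κ : ℚ
        β = ι (suc b)
        κ = + k / suc b
        σt-4≤D₀ : σ * ι t - ι 4 ≤ D 0
        σt-4≤D₀ = by-difference (ι (m ℕ.+ d) + ι (m ℕ.+ d) - ι t + ι 2 - σ * ι t)
          (0≤difference (proj₂ (floor-> {t} {m ℕ.+ d} floor) j (ℕ.m⊔n≤o⇒m≤o J₀ K K≤j) (ℕ.m⊔n≤o⇒n≤o J₀ K K≤j)))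
          (begin
            ι (m ℕ.+ 0) - ι 2
              ≡⟨ cong (λ i → ι i - ι 2) (ℕ.+-identityʳ m) ⟩
            ι m - ι 2
              ≡⟨ solve 3 (λ m d s → m :- con (ι 2) := s :- con (ι 4) :+ ((m :+ d) :+ (m :+ d) :- (m :+ (d :+ d)) :+ con (ι 2) :- s))
                   refl (ι m) (ι d) (σ * ι t) ⟩
            σ * ι t - ι 4 + ((ι m + ι d) + (ι m + ι d) - (ι m + (ι d + ι d)) + ι 2 - σ * ι t)
              ≡⟨ cong₂ (λ y z → σ * ι t - ι 4 + (y + y - z + ι 2 - σ * ι t)) (ι-+ m d)
                   (trans (ι-+ m (d ℕ.+ d)) (cong (λ y → ι m + y) (ι-+ d d))) ⟨
            σ * ι t - ι 4 + (ι (m ℕ.+ d) + ι (m ℕ.+ d) - ι t + ι 2 - σ * ι t) ∎)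
          where open ≡-Reasoning
        small : A (suc d) ≤ ε - x × ρ * A (suc d) ≤ ε
        small = proj₂ (analysis η ε n B 0<η 0<ε) m₀ d (ℕ.m⊔n≤o⇒m≤o t₁ (proj₁ large) t₀≤t) η≤σ σt-4≤D₀ ∣x∣≤B x≤0
          (≤-trans expSum≤ (+-monoʳ-≤ σ (p⊓q≤p (η * ε * ½) γ)))
        2s≤ : ι 2 * ι s ≤ β * ((ε - x) + ε)
        2s≤ = ≤-trans (losses-bound losses ℕ.≤-refl) (subst (_≤ β * ((ε - x) + ε))
          (solve 3 (λ b A r → b :* (A :+ r :* A) := (con 1ℚ :+ r) :* b :* A) refl β (A (suc d)) ρ)
          (*-monoˡ-≤-nonNeg β {{nonNegative (0≤ι (suc b))}} (+-mono-≤ (proj₁ small) (proj₂ small))))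
        covered′ : β * (ι 1 + ι t) ≤ ι k + ι s
        covered′ = subst₂ _≤_ (trans (ι-* (suc b) (suc t)) (cong (β *_) (ι-suc t))) (ι-+ k s) (ι-mono-≤ covered)
        bound : seq (lower-bound ε₀ t) j ≤ κ
        bound = *-cancelʳ-≤-pos β {{positive (0<ι b)}} (by-difference
          ((ι k + ι s - β * (ι 1 + ι t)) + ½ * (β * ((ε - x) + ε) - ι 2 * ι s) + β * (seq ε₀ j - ε))
          (0≤+ (0≤+ (0≤difference covered′) (0≤* (<⇒≤ (positive⁻¹ ½)) (0≤difference 2s≤)))
               (0≤* (0≤ι (suc b)) (0≤difference ε≤εⱼ)))
          (trans (/-* k b) (solve 7 (λ k s b t e x f → k :=
            (((t :+ con (ι 1)) :+ con ½ :* x) :+ :- f) :* b :+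
            ((k :+ s :- b :* (con (ι 1) :+ t)) :+ con ½ :* (b :* ((e :- x) :+ e) :- con (ι 2) :* s) :+ b :* (f :- e)))
            refl (ι k) (ι s) β (ι t) ε x (seq ε₀ j))))

open import Defs
open import Data.Nat.Base as ℕ using (ℕ)
open import Data.Product using (∃-syntax; _×_; _,_)
open import Data.Rational.Base as ℚ using (½)
import Data.Nat.Properties as ℕ
import Data.Rational.Properties as ℚ
open import Relation.Binary.PropositionalEquality using (_≡_; refl)

≤-bound : ∀ {x y q} → y ≃ fromℚ q → ∃[ K ] (∀ j → K ℕ.≤ j → seq x j ℚ.≤ q) → x ≤ y
≤-bound (_ , q≤y) (K , x≤q) δ 0<δ = let N , h = q≤y δ 0<δ in
  K ℕ.⊔ N , λ j K⊔N≤j → ℚ.≤-trans (x≤q j (ℕ.m⊔n≤o⇒m≤o K N K⊔N≤j)) (h j (ℕ.m⊔n≤o⇒n≤o K N K⊔N≤j))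

theorem1p2 : (c : ℝ) → fromℕ 0 < c → c < fromℚ ½ →
    (ℓ : ℝ) → IsLog (fromℕ 1 - fromℕ 2 * c) ℓ →
    (ε : ℝ) → fromℕ 0 < ε →
    ∃[ t₀ ] ((t : ℕ) → t₀ ℕ.≤ t →
    (ω : ℕ) → IsFloor ((fromℕ 1 - c) * fromℕ t) ω →
    ∃[ G ] HasTreewidth G t × IsCliqueNumber G ω ×
    ((x : ℝ) → IsFractionalChromatic G x →
    fromℕ t + fromℕ 1 + fromℚ ½ * ℓ - ε ≤ x))
theorem1p2 c 0<c c<½ ℓ log ε 0<ε = t₀ , λ t t₀≤t ω floor →
  let o , d , ω≡ , t≡ = Analysis.decompose (floor-≤ {t} {ω} floor) (floor-half {t} {ω} t₀≤t floor)
  in graph-for o d ω≡ t≡ t₀≤t floor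
  where
  open Analysis.Limit c 0<c c<½ ℓ log ε 0<ε
    using (t₀; lower-bound; floor-≤; floor-half; chromatic-bound)
  -- A separate function, so that the equations for t and ω can be matched with `refl`; afterwards
  -- the parameters of the construction are t and ω by definition.
  graph-for : ∀ o d {t ω} → ω ≡ ℕ.suc (ℕ.suc o) ℕ.+ d → t ≡ ℕ.suc (ℕ.suc o) ℕ.+ (d ℕ.+ d) →
    t₀ ℕ.≤ t → IsFloor ((fromℕ 1 - c) * fromℕ t) ω →
    ∃[ G ] HasTreewidth G t × IsCliqueNumber G ω ×
      ((x : ℝ) → IsFractionalChromatic G x → lower-bound ε t ≤ x)
  graph-for o d {t = t} refl refl t₀≤t floor =
    let G , treewidth , clique-number , colourings =
          UniversalGraphs.Construction.construction (ℕ.suc o) d (ℕ.s≤s (ℕ.s≤s ℕ.z≤n))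
        K , bound = chromatic-bound (ℕ.suc o) d t₀≤t floor
    in G , treewidth , clique-number , λ x (_ , greatest) →
      -- The bound holds for every ratio of the infimum, whatever b is, because the graph was built
      -- before the colouring was given.
      greatest (lower-bound ε t) λ y (a , k , (colouring , _) , y≃) →
        let s , losses , covered = colourings (ℕ.suc a) k colouring
        in ≤-bound {lower-bound ε t} {y} y≃ (K , λ j K≤j → bound j K≤j losses covered)
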